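{- Let $p$ be a prime, $r\in\mathbb{N}$, $k_1,\ldots,k_r\in\mathbb{Z}$ and $\gamma_1,\ldots,\gamma_r\in\mathbb{Z}_p$. For $s_1,\ldots,s_r\in\mathbb{Z}_p$, the map $$c\mapsto L_{p,r}(s_1,\ldots,s_r;\omega^{k_1},\ldots,\omega^{k_r};\gamma_1,\ldots,\gamma_r;c),$$ defined for $c\in\mathbb{N}_{>1}$ with $(c,p)=1$, is continuously extended to $c\in\mathbb{Z}_p^\times$ as a $p$-adic continuous function. Moreover the extension is uniformly continuous with respect to both parameters $c$ and $(s_j)$. Namely, for any given $\varepsilon>0$, there always exists $\delta>0$ such that $$\left|L_{p,r}(s_1,\ldots,s_r;\omega^{k_1},\ldots,\omega^{k_r};\gamma_1,\ldots,\gamma_r;c)-L_{p,r}(s_1',\ldots,s_r';\omega^{k_1},\ldots,\omega^{k_r};\gamma_1,\ldots,\gamma_r;c')\right|_p<\varepsilon$$ holds for any $c,c'\in\mathbb{Z}_p^\times$ with $|c-c'|_p<\delta$ and $s_j,s_j'\in\mathbb{Z}_p$ with $|s_j-s_j'|_p<\delta$ $(1\leqslant j\leqslant r)$.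
   Context: Put $q=4$ if $p=2$ and $q=p$ if $p\geqslant3$. Let $W=\{\pm1\}$ if $p=2$ and $W=\{\xi\in\mathbb{Z}_p^\times\mid\xi^{p-1}=1\}$ if $p\geqslant3$. Every $x\in\mathbb{Z}_p^\times$ is uniquely $x=\omega(x)\langle x\rangle$ with $\omega(x)\in W$, $\langle x\rangle\in1+q\mathbb{Z}_p$. For $z\in\mathbb{C}_p$ with $|z-1|_p\geqslant1$, $\mathfrak{m}_z$ is the measure on $\mathbb{Z}_p$ with $\mathfrak{m}_z(j+p^N\mathbb{Z}_p)=\frac{z^j}{1-z^{p^N}}$ $(0\leqslant j\leqslant p^N-1)$. For $c\in\mathbb{N}_{>1}$ prime to $p$, $\widetilde{\mathfrak{m}}_c=\sum_{\xi\in\mathbb{C}_p,\,\xi^c=1,\,\xi\neq1}\mathfrak{m}_\xi$; it is a $\mathbb{Z}_p$-valued measure. Integrals of continuous functions are limits of Riemann sums, and on $\mathbb{Z}_p^r$ one uses the product measure. Put $(\mathbb{Z}_p^r)'_{\{\gamma_j\}}=\{(x_j)\in\mathbb{Z}_p^r\mid p\nmid x_1\gamma_1,\ p\nmid(x_1\gamma_1+x_2\gamma_2),\ldots,\ p\nmid\sum_{j=1}^rx_j\gamma_j\}$. The $p$-adic multiple $L$-function is $$L_{p,r}(s_1,\ldots,s_r;\omega^{k_1},\ldots,\omega^{k_r};\gamma_1,\ldots,\gamma_r;c)=\int_{(\mathbb{Z}_p^r)'_{\{\gamma_j\}}}\prod_{i=1}^r\Bigl\langle\sum_{j=1}^ix_j\gamma_j\Bigr\rangle^{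 -s_i}\omega^{k_i}\Bigl(\sum_{j=1}^ix_j\gamma_j\Bigr)\prod_{j=1}^rd\widetilde{\mathfrak{m}}_c(x_j)$$ (the zero function if the domain is empty). -}

module Defs where

open import Level using (Level; _⊔_; 0ℓ)
open import Data.Nat.Base using (ℕ; zero; suc; NonZero; s≤s; z≤n; _!)
import Data.Nat.Base as ℕ
open import Data.Nat.Properties using (_!*_!≢0)
import Data.Nat.Properties as ℕ
import Data.Nat.Divisibility as ℕ
open import Data.Nat.Primality using (Prime; prime⇒nonZero; prime⇒nonTrivial; euclidsLemma)
open import Data.Nat.Combinatorics using (_C_; nCn≡1; nCk≡nC[n∸k]; nCk≡n!/k![n-k]!; k![n∸k]!∣n!)
open import Data.Nat.DivMod using (m/n*n≡m)
open import Data.Nat.Coprimality using (Coprime; coprime-Bézout)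
open import Data.Nat.GCD using (module Bézout)
open import Data.Integer.Base using (ℤ; +_; -[1+_]; 0ℤ; 1ℤ; -1ℤ; _+_; _*_; -_; _-_; _^_)
import Data.Integer.Base as ℤ
open import Data.Integer.Properties using (pos-*; pos-+; ^-*-assoc)
import Data.Integer.Properties as ℤ
open import Data.Integer.DivMod using (n%ℕd<d; _%ℕ_; _/ℕ_; a≡a%ℕn+[a/ℕn]*n)
open import Data.Integer.Divisibility.Signed
open import Data.Integer.Tactic.RingSolver using (solve-∀)
open import Data.Rational.Base using (ℚ; _⊓_)
import Data.Rational.Base as ℚ
import Data.Rational.Literals as ℚ
open import Data.Fin.Base using (Fin; zero; suc; toℕ; fromℕ; inject₁)
import Data.Fin.Properties as Fin
open import Data.Product.Base using (Σ-syntax; ∃; _×_; _,_; proj₁; proj₂)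
open import Data.Sum.Base using (_⊎_; inj₁; inj₂; [_,_]′)
open import Data.Empty using (⊥-elim)
open import Data.Vec.Functional using (Vector; []; _∷_; tail; init; last)
open import Algebra.Apartness.Bundles using (HeytingField; HeytingCommutativeRing)
import Algebra.Apartness.Properties.HeytingCommutativeRing as HeytingProperties
open import Algebra.Bundles using (CommutativeRing; CommutativeSemiring; RawRing)
import Algebra.Definitions.RawSemiring as RawSemiringDefs
open import Algebra.Morphism.Structures using (IsRingHomomorphism)
import Algebra.Properties.CommutativeSemiring.Binomial as Binomial
import Algebra.Properties.Monoid.Mult as MonoidMult
import Algebra.Properties.Monoid.Sum as MonoidSum
import Algebra.Properties.Ring as RingProperties
open import Function.Base using (_∘_)
import Relation.Binary.Reasoning.Setoid as SetoidReasoning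
open import Relation.Nullary using (¬_; ¬?; Dec; yes; no)
open import Relation.Binary.PropositionalEquality

infix 4 _≡_[mod_]

record _≡_[mod_] (a b m : ℤ) : Set where
  constructor mod
  field difference : m ∣ a - b

module _ {m : ℤ} where

  mod-reflexive : ∀ {a b} → a ≡ b → a ≡ b [mod m ]
  mod-reflexive {a} refl = mod (divides 0ℤ (ℤ.+-inverseʳ a))

  mod-refl : ∀ {a} → a ≡ a [mod m ]
  mod-refl = mod-reflexive refl

  mod-sym : ∀ {a b} → a ≡ b [mod m ] → b ≡ a [mod m ]
  mod-sym {a} {b} (mod h) = mod (subst (m ∣_) (eq a b) (∣m⇒∣-m h))
    where
    eq : ∀ a b → - (a - b) ≡ b - a
    eq = solve-∀

  mod-trans : ∀ {a b c} → a ≡ b [mod m ] → b ≡ c [mod m ] → a ≡ c [mod m ]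
  mod-trans {a} {b} {c} (mod h) (mod k) = mod (subst (m ∣_) (eq a b c) (∣m∣n⇒∣m+n h k))
    where
    eq : ∀ a b c → (a - b) + (b - c) ≡ a - c
    eq = solve-∀

  mod-+ : ∀ {a b c d} → a ≡ b [mod m ] → c ≡ d [mod m ] → a + c ≡ b + d [mod m ]
  mod-+ {a} {b} {c} {d} (mod h) (mod k) = mod (subst (m ∣_) (eq a b c d) (∣m∣n⇒∣m+n h k))
    where
    eq : ∀ a b c d → (a - b) + (c - d) ≡ (a + c) - (b + d)
    eq = solve-∀

  mod-neg : ∀ {a b} → a ≡ b [mod m ] → - a ≡ - b [mod m ]
  mod-neg {a} {b} (mod h) = mod (subst (m ∣_) (eq a b) (∣m⇒∣-m h))
    where
    eq : ∀ a b → - (a - b) ≡ - a - - b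
    eq = solve-∀

  mod-* : ∀ {a b c d} → a ≡ b [mod m ] → c ≡ d [mod m ] → a * c ≡ b * d [mod m ]
  mod-* {a} {b} {c} {d} (mod h) (mod k) =
    mod (subst (m ∣_) (eq a b c d) (∣m∣n⇒∣m+n (∣n⇒∣m*n a k) (∣m⇒∣m*n d h)))
    where
    eq : ∀ a b c d → a * (c - d) + (a - b) * d ≡ a * c - b * d
    eq = solve-∀

  mod-^ : ∀ {a b} n → a ≡ b [mod m ] → a ^ n ≡ b ^ n [mod m ]
  mod-^ zero    h = mod-refl
  mod-^ (suc n) h = mod-* h (mod-^ n h)

  mod⇒∣ : ∀ {a b} → a ≡ b [mod m ] → m ∣ a → m ∣ b
  mod⇒∣ {a} {b} (mod h) k = subst (m ∣_) (eq a b) (∣m∣n⇒∣m-n k h)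
    where
    eq : ∀ a b → a - (a - b) ≡ b
    eq = solve-∀

mod-weaken : ∀ {m n a b} → m ∣ n → a ≡ b [mod n ] → a ≡ b [mod m ]
mod-weaken h (mod k) = mod (∣-trans h k)

*-^-comm : ∀ a b n → (a * b) ^ n ≡ a ^ n * b ^ n
*-^-comm a b zero    = refl
*-^-comm a b (suc n) rewrite *-^-comm a b n = eq a b (a ^ n) (b ^ n)
  where
  eq : ∀ a b c d → (a * b) * (c * d) ≡ (a * c) * (b * d)
  eq = solve-∀

pos-^ : ∀ a n → + (a ℕ.^ n) ≡ (+ a) ^ n
pos-^ a zero    = refl
pos-^ a (suc n) = trans (pos-* a (a ℕ.^ n)) (cong ((+ a) *_) (pos-^ a n))

geom : ℤ → ℤ → ℕ → ℤ
geom a b zero    = 0ℤ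
geom a b (suc n) = a * geom a b n + b ^ n

geom-telescopes : ∀ a b n → a ^ n - b ^ n ≡ (a - b) * geom a b n
geom-telescopes a b zero    = sym (ℤ.*-zeroʳ (a - b))
geom-telescopes a b (suc n) = begin
  a * a ^ n - b * b ^ n                 ≡⟨ eq₁ a b (a ^ n) (b ^ n) ⟩
  a * (a ^ n - b ^ n) + (a - b) * b ^ n ≡⟨ cong (λ t → a * t + (a - b) * b ^ n) (geom-telescopes a b n) ⟩
  a * ((a - b) * geom a b n) + (a - b) * b ^ n ≡⟨ eq₂ a b (geom a b n) (b ^ n) ⟩
  (a - b) * geom a b (suc n)            ∎
  where
  open ≡-Reasoning
  eq₁ : ∀ a b x y → a * x - b * y ≡ a * (x - y) + (a - b) * y
  eq₁ = solve-∀
  eq₂ : ∀ a b g y → a * ((a - b) * g) + (a - b) * y ≡ (a - b) * (a * g + y)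
  eq₂ = solve-∀

geom-diagonal : ∀ {m a b} n → a ≡ b [mod m ] → geom a b (suc n) ≡ + suc n * b ^ n [mod m ]
geom-diagonal {m} {a} {b} zero    h = mod-reflexive (cong (_+ 1ℤ) (ℤ.*-zeroʳ a))
geom-diagonal {m} {a} {b} (suc n) h =
  mod-trans (mod-+ (mod-* h (geom-diagonal n h)) mod-refl)
            (mod-reflexive (eq b (+ suc n) (b ^ n)))
  where
  eq : ∀ b k x → b * (k * x) + b * x ≡ (1ℤ + k) * (b * x)
  eq = solve-∀

module Padic (p : ℕ) (p-prime : Prime p) where

  private instance
    p≢0 : NonZero p
    p≢0 = prime⇒nonZero p-prime

  p∤k! : ∀ k → k ℕ.< p → ¬ p ℕ.∣ k !
  p∤k! zero    _   h = ℕ.>⇒∤ (ℕ.nonTrivial⇒n>1 p {{prime⇒nonTrivial p-prime}}) h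
  p∤k! (suc k) k<p h with euclidsLemma (suc k) (k !) p-prime h
  ... | inj₁ p∣1+k = ℕ.>⇒∤ k<p p∣1+k
  ... | inj₂ p∣k!  = p∤k! k (ℕ.<⇒≤ k<p) p∣k!

  p∣pCk : ∀ k → 0 ℕ.< k → k ℕ.< p → p ℕ.∣ p C k
  p∣pCk k 0<k k<p = [ (λ h → h) , (λ h → ⊥-elim (notDen h)) ]′
      (euclidsLemma (p C k) (k ! ℕ.* (p ℕ.∸ k) !) p-prime (subst (p ℕ.∣_) (sym C*den) p∣p!))
    where
    instance _ = k !* (p ℕ.∸ k) !≢0
    C*den : (p C k) ℕ.* (k ! ℕ.* (p ℕ.∸ k) !) ≡ p !
    C*den = trans (cong (ℕ._* (k ! ℕ.* (p ℕ.∸ k) !)) (nCk≡n!/k![n-k]! (ℕ.<⇒≤ k<p)))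
                  (m/n*n≡m (k![n∸k]!∣n! (ℕ.<⇒≤ k<p)))
    p∣n! : ∀ n .{{_ : NonZero n}} → n ℕ.∣ n !
    p∣n! (suc n) = ℕ.m∣m*n (n !)
    p∣p! : p ℕ.∣ p !
    p∣p! = p∣n! p
    notDen : ¬ p ℕ.∣ k ! ℕ.* (p ℕ.∸ k) !
    notDen h = [ p∤k! k k<p , p∤k! (p ℕ.∸ k) (ℕ.∸-monoʳ-< 0<k (ℕ.<⇒≤ k<p)) ]′
                 (euclidsLemma (k !) ((p ℕ.∸ k) !) p-prime h)

  p∣sum : ∀ {n} (t : Vector ℕ n) → (∀ i → p ℕ.∣ t i) → p ℕ.∣ MonoidSum.sum ℕ.+-0-monoid t
  p∣sum {zero}  t h = p ℕ.∣0
  p∣sum {suc n} t h = ℕ.∣m∣n⇒∣m+n (h zero) (p∣sum (tail t) (h ∘ suc))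

  freshman : ∀ a → ∃ λ Q → p ℕ.∣ Q × (a ℕ.+ 1) ℕ.^ p ≡ 1 ℕ.+ (Q ℕ.+ a ℕ.^ p)
  freshman a = go p refl
    where
    module B = Binomial ℕ.+-*-commutativeSemiring
    module S = MonoidSum ℕ.+-0-monoid
    open import Algebra.Definitions.RawSemiring (CommutativeSemiring.rawSemiring ℕ.+-*-commutativeSemiring)
      using () renaming (_^_ to _^′_; _×_ to _·_)
    ^′≡^ : ∀ x n → x ^′ n ≡ x ℕ.^ n
    ^′≡^ x zero    = refl
    ^′≡^ x (suc n) = cong (x ℕ.*_) (^′≡^ x n)
    ·≡* : ∀ n x → n · x ≡ n ℕ.* x
    ·≡* zero    x = refl
    ·≡* (suc n) x = cong (x ℕ.+_) (·≡* n x)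
    term : ∀ n → Vector ℕ (suc n)
    term n i = (n C toℕ i) · ((a ^′ toℕ i) ℕ.* (1 ^′ (n ℕ.∸ toℕ i)))
    go : ∀ n → n ≡ p → ∃ λ Q → p ℕ.∣ Q × (a ℕ.+ 1) ℕ.^ n ≡ 1 ℕ.+ (Q ℕ.+ a ℕ.^ n)
    go zero    refl = ⊥-elim (ℕ.≢-nonZero⁻¹ p refl)
    go (suc n) eq   = S.sum (init (tail t)) , p∣sum _ mid , total
      where
      open ≡-Reasoning
      t : Vector ℕ (suc (suc n))
      t = term (suc n)
      mid : ∀ i → p ℕ.∣ init (tail t) i
      mid i = subst (p ℕ.∣_) (sym (·≡* (suc n C k) _))
        (ℕ.∣m⇒∣m*n _ (subst (λ m → p ℕ.∣ m C k) (sym eq)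
          (p∣pCk k (s≤s z≤n) (subst (k ℕ.<_) eq (s≤s (subst (ℕ._< n) (sym (Fin.toℕ-inject₁ i)) (Fin.toℕ<n i)))))))
        where
        k = toℕ (suc (inject₁ i))
      firstTerm : t zero ≡ 1
      firstTerm = trans (cong₂ _·_ (nC0 (suc n)) (trans (ℕ.+-identityʳ _) (trans (^′≡^ 1 (suc n)) (ℕ.^-zeroˡ (suc n))))) refl
        where
        nC0 : ∀ m → m C 0 ≡ 1
        nC0 m = trans (nCk≡nC[n∸k] {0} {m} z≤n) (nCn≡1 m)
      lastTerm : last (tail t) ≡ a ℕ.^ suc n
      lastTerm = begin
        (suc n C suc k) · ((a ^′ suc k) ℕ.* (1 ^′ (n ℕ.∸ k))) ≡⟨ cong (λ m → (suc n C suc m) · ((a ^′ suc m) ℕ.* (1 ^′ (n ℕ.∸ m)))) (Fin.toℕ-fromℕ n) ⟩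
        (suc n C suc n) · ((a ^′ suc n) ℕ.* (1 ^′ (n ℕ.∸ n))) ≡⟨ cong₂ _·_ (nCn≡1 (suc n)) (cong (λ m → (a ^′ suc n) ℕ.* (1 ^′ m)) (ℕ.n∸n≡0 n)) ⟩
        1 · ((a ^′ suc n) ℕ.* 1) ≡⟨ ℕ.+-identityʳ _ ⟩
        (a ^′ suc n) ℕ.* 1       ≡⟨ ℕ.*-identityʳ _ ⟩
        a ^′ suc n               ≡⟨ ^′≡^ a (suc n) ⟩
        a ℕ.^ suc n              ∎
        where
        k = toℕ (fromℕ n)
      total : (a ℕ.+ 1) ℕ.^ suc n ≡ 1 ℕ.+ (S.sum (init (tail t)) ℕ.+ a ℕ.^ suc n)
      total = begin
        (a ℕ.+ 1) ℕ.^ suc n        ≡⟨ ^′≡^ (a ℕ.+ 1) (suc n) ⟨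
        (a ℕ.+ 1) ^′ suc n         ≡⟨ B.theorem (suc n) a 1 ⟩
        t zero ℕ.+ S.sum (tail t)  ≡⟨ cong₂ ℕ._+_ firstTerm (trans (S.sum-init-last (tail t)) (cong (S.sum (init (tail t)) ℕ.+_) lastTerm)) ⟩
        1 ℕ.+ (S.sum (init (tail t)) ℕ.+ a ℕ.^ suc n) ∎

  fermat-ℕ : ∀ a → (+ a) ^ p ≡ + a [mod + p ]
  fermat-ℕ zero = mod-reflexive (0^ p)
    where
    0^ : ∀ n .{{_ : NonZero n}} → 0ℤ ^ n ≡ 0ℤ
    0^ (suc n) = refl
  fermat-ℕ (suc a) with freshman a
  ... | Q , p∣Q , eq = mod-trans (mod-reflexive lhs) step
    where
    open ≡-Reasoning
    lhs : (+ suc a) ^ p ≡ 1ℤ + (+ Q + (+ a) ^ p)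
    lhs = begin
      (+ suc a) ^ p                     ≡⟨ pos-^ (suc a) p ⟨
      + (suc a ℕ.^ p)                   ≡⟨ cong (λ m → + (m ℕ.^ p)) (ℕ.+-comm 1 a) ⟩
      + ((a ℕ.+ 1) ℕ.^ p)               ≡⟨ cong +_ eq ⟩
      + (1 ℕ.+ (Q ℕ.+ a ℕ.^ p))         ≡⟨ pos-+ 1 _ ⟩
      1ℤ + + (Q ℕ.+ a ℕ.^ p)            ≡⟨ cong (λ z → 1ℤ + z) (pos-+ Q _) ⟩
      1ℤ + (+ Q + + (a ℕ.^ p))          ≡⟨ cong (λ z → 1ℤ + (+ Q + z)) (pos-^ a p) ⟩
      1ℤ + (+ Q + (+ a) ^ p)            ∎
    Q≡0 : + Q ≡ 0ℤ [mod + p ]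
    Q≡0 = mod (subst (+ p ∣_) (sym (ℤ.+-identityʳ (+ Q))) (∣ᵤ⇒∣ p∣Q))
    step : 1ℤ + (+ Q + (+ a) ^ p) ≡ 1ℤ + (0ℤ + + a) [mod + p ]
    step = mod-+ (mod-refl {a = 1ℤ}) (mod-+ Q≡0 (fermat-ℕ a))

  fermat : ∀ a → a ^ p ≡ a [mod + p ]
  fermat a = mod-trans (mod-^ p a≡r) (mod-trans (fermat-ℕ r) (mod-sym a≡r))
    where
    r = a %ℕ p
    eq : ∀ x y → (x + y) - x ≡ y
    eq = solve-∀
    a≡r : a ≡ + r [mod + p ]
    a≡r = mod (divides (a /ℕ p) (trans (cong (_- + r) (a≡a%ℕn+[a/ℕn]*n a p)) (eq (+ r) _)))

  fermat-unit : ∀ a → ¬ + p ∣ a → a ^ ℕ.pred p ≡ 1ℤ [mod + p ]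
  fermat-unit a p∤a with euclidsLemma ℤ.∣ a ∣ ℤ.∣ a ^ ℕ.pred p - 1ℤ ∣ p-prime
                           (subst (p ℕ.∣_) (ℤ.abs-* a _) (∣⇒∣ᵤ (subst (+ p ∣_) (eq p) (_≡_[mod_].difference (fermat a)))))
    where
    eq′ : ∀ x y → x * y - x ≡ x * (y - 1ℤ)
    eq′ = solve-∀
    eq : ∀ n .{{_ : NonZero n}} → a ^ n - a ≡ a * (a ^ ℕ.pred n - 1ℤ)
    eq (suc n) = eq′ a (a ^ n)
  ... | inj₁ h = ⊥-elim (p∤a (∣ᵤ⇒∣ h))
  ... | inj₂ h = mod (∣ᵤ⇒∣ h)

  P : ℕ → ℤ
  P n = + (p ℕ.^ n)

  P-suc : ∀ n → P (suc n) ≡ + p * P n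
  P-suc n = pos-* p (p ℕ.^ n)

  P1≡p : P 1 ≡ + p
  P1≡p = cong +_ (ℕ.*-identityʳ p)

  P-mono : ∀ {m n} → m ℕ.≤ n → P m ∣ P n
  P-mono {m} {n} m≤n = ∣ᵤ⇒∣ (subst (p ℕ.^ m ℕ.∣_)
    (trans (sym (ℕ.^-distribˡ-+-* p m (n ℕ.∸ m))) (cong (p ℕ.^_) (ℕ.m+[n∸m]≡n m≤n)))
    (ℕ.m∣m*n (p ℕ.^ (n ℕ.∸ m))))

  P0∣ : ∀ a → P 0 ∣ a
  P0∣ a = divides a (sym (ℤ.*-identityʳ a))

  p-th-power-lift : ∀ k {a b} → a ≡ b [mod P (suc k) ] → a ^ p ≡ b ^ p [mod P (suc (suc k)) ]
  p-th-power-lift k {a} {b} h@(mod (divides q a-b≡)) = mod (divides (q * r) (begin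
      a ^ p - b ^ p            ≡⟨ geom-telescopes a b p ⟩
      (a - b) * geom a b p     ≡⟨ cong₂ _*_ a-b≡ geom≡ ⟩
      (q * P (suc k)) * (r * + p) ≡⟨ eq q (P (suc k)) r (+ p) ⟩
      (q * r) * (+ p * P (suc k)) ≡⟨ cong ((q * r) *_) (P-suc (suc k)) ⟨
      (q * r) * P (suc (suc k)) ∎))
    where
    open ≡-Reasoning
    eq : ∀ q x r y → (q * x) * (r * y) ≡ (q * r) * (y * x)
    eq = solve-∀
    p∣geom : ∀ n .{{_ : NonZero n}} → a ≡ b [mod + n ] → + n ∣ geom a b n
    p∣geom (suc n) e = mod⇒∣ (mod-sym (geom-diagonal n e)) (∣m⇒∣m*n (b ^ n) ∣-refl)
    h₁ : a ≡ b [mod + p ]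
    h₁ = subst (λ m → a ≡ b [mod m ]) P1≡p (mod-weaken (P-mono {1} {suc k} (s≤s z≤n)) h)
    r = _∣_.quotient (p∣geom p h₁)
    geom≡ = _∣_.equality (p∣geom p h₁)

  power-lift : ∀ n {a b} → a ≡ b [mod + p ] → a ^ (p ℕ.^ n) ≡ b ^ (p ℕ.^ n) [mod P (suc n) ]
  power-lift zero    {a} {b} h = mod-^ 1 (subst (λ m → a ≡ b [mod m ]) (sym P1≡p) h)
  power-lift (suc n) {a} {b} h =
    subst₂ (λ x y → x ≡ y [mod P (suc (suc n)) ]) (eq a) (eq b) (p-th-power-lift n (power-lift n h))
    where
    eq : ∀ a → (a ^ (p ℕ.^ n)) ^ p ≡ a ^ (p ℕ.^ suc n)
    eq a = trans (^-*-assoc a (p ℕ.^ n) p) (cong (a ^_) (ℕ.*-comm (p ℕ.^ n) p))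

  1^ : ∀ n → 1ℤ ^ n ≡ 1ℤ
  1^ = ℤ.^-zeroˡ

  euler : ∀ n a → ¬ + p ∣ a → (a ^ (p ℕ.^ n)) ^ ℕ.pred p ≡ 1ℤ [mod P (suc n) ]
  euler n a p∤a = mod-trans (mod-reflexive eq)
    (mod-trans (power-lift n (fermat-unit a p∤a)) (mod-reflexive (1^ (p ℕ.^ n))))
    where
    eq : (a ^ (p ℕ.^ n)) ^ ℕ.pred p ≡ (a ^ ℕ.pred p) ^ (p ℕ.^ n)
    eq = trans (^-*-assoc a (p ℕ.^ n) (ℕ.pred p))
           (trans (cong (a ^_) (ℕ.*-comm (p ℕ.^ n) (ℕ.pred p))) (sym (^-*-assoc a (ℕ.pred p) (p ℕ.^ n))))

  -- ℤₚ is the inverse limit of the rings ℤ/pⁿ: an element is a sequence of integers whose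
  -- n-th term represents it modulo pⁿ, and equality is congruence modulo pⁿ for every n.

  record ℤₚ : Set where
    field
      approx   : ℕ → ℤ
      coherent : ∀ n → approx (suc n) ≡ approx n [mod P n ]

  open ℤₚ public

  infix  4 _≈ₚ_ _∣ₚ_
  infixl 6 _+ₚ_ _-ₚ_
  infixl 7 _*ₚ_
  infix  8 -ₚ_

  record _≈ₚ_ (x y : ℤₚ) : Set where
    constructor equal
    field approx-≡ : ∀ n → approx x n ≡ approx y n [mod P n ]

  open _≈ₚ_ public

  fromℤ : ℤ → ℤₚ
  fromℤ a = record { approx = λ _ → a ; coherent = λ _ → mod-refl }

  0ₚ 1ₚ : ℤₚ
  0ₚ = fromℤ 0ℤ
  1ₚ = fromℤ 1ℤ

  _+ₚ_ _*ₚ_ : ℤₚ → ℤₚ → ℤₚ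
  x +ₚ y = record { approx   = λ n → approx x n + approx y n
                  ; coherent = λ n → mod-+ (coherent x n) (coherent y n) }
  x *ₚ y = record { approx   = λ n → approx x n * approx y n
                  ; coherent = λ n → mod-* (coherent x n) (coherent y n) }

  -ₚ_ : ℤₚ → ℤₚ
  -ₚ x = record { approx = λ n → - approx x n ; coherent = λ n → mod-neg (coherent x n) }

  _-ₚ_ : ℤₚ → ℤₚ → ℤₚ
  x -ₚ y = x +ₚ (-ₚ y)

  ℤₚ-rawRing : RawRing 0ℓ 0ℓ
  ℤₚ-rawRing = record
    { Carrier = ℤₚ ; _≈_ = _≈ₚ_ ; _+_ = _+ₚ_ ; _*_ = _*ₚ_ ; -_ = -ₚ_ ; 0# = 0ₚ ; 1# = 1ₚ }

  open RawSemiringDefs (RawRing.rawSemiring ℤₚ-rawRing) public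
    using () renaming (_^_ to _^ₚ_; product to ∏ₚ)

  -- n ∣ₚ x says x ∈ pⁿℤₚ, that is |x|ₚ ≤ p⁻ⁿ.

  _∣ₚ_ : ℕ → ℤₚ → Set
  n ∣ₚ x = P n ∣ approx x n

  approx-≤ : ∀ x {m n} → m ℕ.≤ n → approx x n ≡ approx x m [mod P m ]
  approx-≤ x {m} {n} m≤n = subst (λ k → approx x k ≡ approx x m [mod P m ]) (ℕ.m∸n+n≡m m≤n) (go (n ℕ.∸ m))
    where
    go : ∀ d → approx x (d ℕ.+ m) ≡ approx x m [mod P m ]
    go zero    = mod-refl
    go (suc d) = mod-trans (mod-weaken (P-mono (ℕ.m≤n+m m d)) (coherent x (d ℕ.+ m))) (go d)

  approx-^ : ∀ x k n → approx (x ^ₚ k) n ≡ approx x n ^ k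
  approx-^ x zero    n = refl
  approx-^ x (suc k) n = cong (approx x n *_) (approx-^ x k n)

  mod-P0 : ∀ {a b} → a ≡ b [mod P 0 ]
  mod-P0 = mod (P0∣ _)

  *ₚ-inverse-unique : ∀ {m a a′ z z′} → a ≡ a′ [mod m ] → a * z ≡ 1ℤ [mod m ] → a′ * z′ ≡ 1ℤ [mod m ] →
                      z ≡ z′ [mod m ]
  *ₚ-inverse-unique {m} {a} {a′} {z} {z′} a≡a′ az≡1 a′z′≡1 =
    mod-trans (mod-reflexive (sym (ℤ.*-identityʳ z)))
    (mod-trans (mod-* (mod-refl {a = z}) (mod-sym a′z′≡1))
    (mod-trans (mod-* (mod-refl {a = z}) (mod-* (mod-sym a≡a′) (mod-refl {a = z′})))
    (mod-trans (mod-reflexive (eq z a z′))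
    (mod-trans (mod-* az≡1 (mod-refl {a = z′})) (mod-reflexive (ℤ.*-identityˡ z′))))))
    where
    eq : ∀ z a z′ → z * (a * z′) ≡ (a * z) * z′
    eq = solve-∀

  record ℤₚˣ : Set where
    field
      value    : ℤₚ
      inverse  : ℤₚ
      inverseʳ : value *ₚ inverse ≈ₚ 1ₚ

  open ℤₚˣ public

  _⁻¹ : ℤₚˣ → ℤₚˣ
  u ⁻¹ = record
    { value = inverse u ; inverse = value u
    ; inverseʳ = equal λ n → mod-trans (mod-reflexive (ℤ.*-comm (approx (inverse u) n) _)) (approx-≡ (inverseʳ u) n) }

  infixr 8 _^ˣ_

  _^ˣ_ : ℤₚˣ → ℤ → ℤₚ
  u ^ˣ (+ n)    = value u ^ₚ n
  u ^ˣ -[1+ n ] = inverse u ^ₚ suc n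

  unit : (x : ℤₚ) → ¬ 1 ∣ₚ x → ℤₚˣ
  unit x p∤x = record
    { value    = x
    ; inverse  = record { approx = λ n → inv n ; coherent = λ n → *ₚ-inverse-unique
                   (coherent x n) (mod-weaken (P-mono (ℕ.n≤1+n n)) (inv-correct (suc n))) (inv-correct n) }
    ; inverseʳ = equal inv-correct }
    where
    inv : ℕ → ℤ
    inv n = approx x n ^ ℕ.pred (p ℕ.^ n ℕ.* ℕ.pred p)
    p∤xₙ : ∀ n → ¬ + p ∣ approx x (suc n)
    p∤xₙ n h = p∤x (mod⇒∣ (approx-≤ x {1} {suc n} (s≤s z≤n)) (subst (_∣ approx x (suc n)) (sym P1≡p) h))
    pred-nonZero : ∀ n → NonZero (p ℕ.^ n ℕ.* ℕ.pred p)
    pred-nonZero n = ℕ.m*n≢0 (p ℕ.^ n) (ℕ.pred p) {{ℕ.m^n≢0 p n}}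
      {{ℕ.>-nonZero (ℕ.pred-mono-≤ (ℕ.nonTrivial⇒n>1 p {{prime⇒nonTrivial p-prime}}))}}
    *-pred : ∀ a m .{{_ : NonZero m}} → a * a ^ ℕ.pred m ≡ a ^ m
    *-pred a (suc m) = refl
    inv-correct : ∀ n → approx x n * inv n ≡ 1ℤ [mod P n ]
    inv-correct zero      = mod-P0
    inv-correct n@(suc m) = mod-trans
      (mod-reflexive (trans (*-pred (approx x n) _ {{pred-nonZero n}})
                            (sym (^-*-assoc (approx x n) (p ℕ.^ n) (ℕ.pred p)))))
      (mod-weaken (P-mono (ℕ.n≤1+n n)) (euler n (approx x n) (p∤xₙ m)))

  p∤unit : ∀ u n → ¬ + p ∣ approx (value u) (suc n)
  p∤unit u n p∣u = ℕ.>⇒∤ (ℕ.nonTrivial⇒n>1 p {{prime⇒nonTrivial p-prime}}) (∣⇒∣ᵤ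
    (mod⇒∣ (mod-weaken (subst (_∣ P (suc n)) P1≡p (P-mono {1} {suc n} (s≤s z≤n))) (approx-≡ (inverseʳ u) (suc n)))
      (∣m⇒∣m*n (approx (inverse u) (suc n)) p∣u)))

  -- q = p ^ q-exponent, i.e. q = 4 for p = 2 and q = p otherwise.

  q-exponent : ℕ
  q-exponent with p ℕ.≟ 2
  ... | yes _ = 2
  ... | no  _ = 1

  q-cases : (p ≡ 2 × q-exponent ≡ 2) ⊎ (p ≢ 2 × q-exponent ≡ 1)
  q-cases with p ℕ.≟ 2
  ... | yes p≡2 = inj₁ (p≡2 , refl)
  ... | no  p≢2 = inj₂ (p≢2 , refl)

  1≤q-exponent : 1 ℕ.≤ q-exponent
  1≤q-exponent with p ℕ.≟ 2
  ... | yes _ = s≤s z≤n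
  ... | no  _ = s≤s z≤n

  W : ℤₚˣ → Set
  W ξ = (p ≡ 2 × (value ξ ≈ₚ 1ₚ ⊎ value ξ ≈ₚ -ₚ 1ₚ)) ⊎ (p ≢ 2 × value ξ ^ₚ ℕ.pred p ≈ₚ 1ₚ)

  record 1+qℤₚ : Set where
    field
      value     : ℤₚ
      principal : q-exponent ∣ₚ value -ₚ 1ₚ

  -- x = ω(x)⟨x⟩; the two factors are uniquely determined by x.

  record Decomposition (x : ℤₚˣ) : Set where
    field
      ω       : ℤₚˣ
      ω∈W     : W ω
      ⟨x⟩     : 1+qℤₚ
      factors : value x ≈ₚ value ω *ₚ 1+qℤₚ.value ⟨x⟩

  -- For odd p, ω(x) = lim x ^ (p ^ n), and the n-th term is already correct modulo pⁿ.

  teichmüller : ℤₚ → ℤₚ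
  teichmüller x = record
    { approx   = λ n → approx x n ^ (p ℕ.^ n)
    ; coherent = λ n → mod-trans (mod-^ (p ℕ.^ suc n) (coherent x n))
        (mod-trans (mod-reflexive (sym (^-*-assoc (approx x n) p (p ℕ.^ n))))
                   (mod-weaken (P-mono (ℕ.n≤1+n n)) (power-lift n (fermat (approx x n)))))
    }

  decompose : ∀ x → Decomposition x
  decompose x = [ (λ (p≡2 , q≡) → even p≡2 q≡) , (λ (p≢2 , q≡) → odd p≢2 q≡) ]′ q-cases
    where
    x₀ = value x
    x⁻ = inverse x

    split : ∀ {a w w⁻ m} → w * w⁻ ≡ 1ℤ [mod m ] → a ≡ w * (a * w⁻) [mod m ]
    split {a} {w} {w⁻} h = mod-trans (mod-reflexive (sym (ℤ.*-identityʳ a)))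
      (mod-trans (mod-* (mod-refl {a = a}) (mod-sym h)) (mod-reflexive (eq a w w⁻)))
      where
      eq : ∀ a w v → a * (w * v) ≡ w * (a * v)
      eq = solve-∀

    odd : p ≢ 2 → q-exponent ≡ 1 → Decomposition x
    odd p≢2 q≡ = record
      { ω       = ω
      ; ω∈W     = inj₂ (p≢2 , equal root)
      ; ⟨x⟩     = record { value = x₀ *ₚ inverse ω
                         ; principal = subst (_∣ₚ x₀ *ₚ inverse ω -ₚ 1ₚ) (sym q≡) (_≡_[mod_].difference close) }
      ; factors = equal λ n → split {w = approx (value ω) n} {w⁻ = approx (inverse ω) n} (approx-≡ (inverseʳ ω) n)
      }
      where
      ω : ℤₚˣ
      ω = record { value = teichmüller x₀ ; inverse = teichmüller x⁻
                 ; inverseʳ = equal λ n → mod-trans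
                     (mod-reflexive (sym (*-^-comm (approx x₀ n) (approx x⁻ n) (p ℕ.^ n))))
                     (mod-trans (mod-^ (p ℕ.^ n) (approx-≡ (inverseʳ x) n)) (mod-reflexive (1^ (p ℕ.^ n)))) }
      root : ∀ n → approx (teichmüller x₀ ^ₚ ℕ.pred p) n ≡ 1ℤ [mod P n ]
      root zero      = mod-P0
      root n@(suc m) = mod-trans (mod-reflexive (approx-^ (teichmüller x₀) (ℕ.pred p) n))
        (mod-weaken (P-mono (ℕ.n≤1+n n)) (euler n (approx x₀ n) (p∤unit x m)))
      close : approx (x₀ *ₚ inverse ω) 1 ≡ 1ℤ [mod P 1 ]
      close = mod-trans (mod-* (mod-refl {a = approx x₀ 1})
          (subst (λ m → approx x⁻ 1 ^ (p ℕ.^ 1) ≡ approx x⁻ 1 [mod m ]) (sym P1≡p)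
            (subst (λ e → approx x⁻ 1 ^ e ≡ approx x⁻ 1 [mod + p ]) (sym (ℕ.*-identityʳ p)) (fermat (approx x⁻ 1)))))
        (approx-≡ (inverseʳ x) 1)

    even : p ≡ 2 → q-exponent ≡ 2 → Decomposition x
    even p≡2 q≡ with P 2 ∣? approx x₀ 2 - 1ℤ
    ... | yes h = record
      { ω = record { value = 1ₚ ; inverse = 1ₚ ; inverseʳ = equal λ _ → mod-refl }
      ; ω∈W = inj₁ (p≡2 , inj₁ (equal λ _ → mod-refl))
      ; ⟨x⟩ = record { value = x₀ ; principal = subst (_∣ₚ x₀ -ₚ 1ₚ) (sym q≡) h }
      ; factors = equal λ n → mod-reflexive (sym (ℤ.*-identityˡ (approx x₀ n)))
      }
    ... | no h = record
      { ω = record { value = -ₚ 1ₚ ; inverse = -ₚ 1ₚ ; inverseʳ = equal λ _ → mod-refl }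
      ; ω∈W = inj₁ (p≡2 , inj₂ (equal λ _ → mod-refl))
      ; ⟨x⟩ = record { value = -ₚ x₀ ; principal = subst (_∣ₚ -ₚ x₀ -ₚ 1ₚ) (sym q≡) (_≡_[mod_].difference (mod-neg x≡-1)) }
      ; factors = equal λ n → mod-reflexive (eq (approx x₀ n))
      }
      where
      eq : ∀ a → a ≡ - 1ℤ * - a
      eq = solve-∀
      P2≡4 : P 2 ≡ + 4
      P2≡4 = cong (λ t → + (t ℕ.^ 2)) p≡2
      residues : ∀ a b → a * b ≡ 1ℤ [mod + 4 ] → ¬ + 4 ∣ a - 1ℤ → a ≡ -1ℤ [mod + 4 ]
      residues a b ab≡1 a≢1 = by-residue (a %ℕ 4) (a /ℕ 4) (a≡a%ℕn+[a/ℕn]*n a 4) (n%ℕd<d a 4)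
        where
        two∤1 : ∀ c → c * + 2 ≢ 1ℤ
        two∤1 c h = ℕ.>⇒∤ {1} {2} (s≤s (s≤s z≤n)) (∣⇒∣ᵤ (divides {+ 2} c (sym h)))
        parity : ∀ c → a ≢ c * + 2
        parity c a≡2c = two∤1 (c * b - k * + 2) (trans (eq₂ c b k)
            (trans (cong₂ (λ t u → t * b - u) (sym a≡2c) (sym (_∣_.equality ab-1))) (eq₃ (a * b))))
          where
          ab-1 = _≡_[mod_].difference ab≡1
          k = _∣_.quotient ab-1
          eq₂ : ∀ c b k → (c * b - k * + 2) * + 2 ≡ (c * + 2) * b - k * + 4
          eq₂ = solve-∀
          eq₃ : ∀ t → t - (t - 1ℤ) ≡ 1ℤ
          eq₃ = solve-∀
        by-residue : ∀ r d → a ≡ + r + d * + 4 → r ℕ.< 4 → a ≡ -1ℤ [mod + 4 ]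
        by-residue 0 d e _ = ⊥-elim (parity (d * + 2) (trans e (eq₄ d)))
          where
          eq₄ : ∀ d → + 0 + d * + 4 ≡ (d * + 2) * + 2
          eq₄ = solve-∀
        by-residue 1 d e _ = ⊥-elim (a≢1 (divides d (trans (cong (_- 1ℤ) e) (eq₄ d))))
          where
          eq₄ : ∀ d → (+ 1 + d * + 4) - 1ℤ ≡ d * + 4
          eq₄ = solve-∀
        by-residue 2 d e _ = ⊥-elim (parity (1ℤ + d * + 2) (trans e (eq₄ d)))
          where
          eq₄ : ∀ d → + 2 + d * + 4 ≡ (1ℤ + d * + 2) * + 2
          eq₄ = solve-∀
        by-residue 3 d e _ = mod (divides (1ℤ + d) (trans (cong (_- -1ℤ) e) (eq₄ d)))
          where
          eq₄ : ∀ d → (+ 3 + d * + 4) - -1ℤ ≡ (1ℤ + d) * + 4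
          eq₄ = solve-∀
        by-residue (suc (suc (suc (suc r)))) d e (s≤s (s≤s (s≤s (s≤s ()))))
      x≡-1 : approx x₀ 2 ≡ -1ℤ [mod P 2 ]
      x≡-1 = subst (λ m → approx x₀ 2 ≡ -1ℤ [mod m ]) (sym P2≡4)
        (residues (approx x₀ 2) (approx x⁻ 2)
          (subst (λ m → approx x₀ 2 * approx x⁻ 2 ≡ 1ℤ [mod m ]) P2≡4 (approx-≡ (inverseʳ x) 2))
          (λ d → h (subst (_∣ approx x₀ 2 - 1ℤ) (sym P2≡4) d)))

  -- For u ∈ 1+qℤₚ and s ∈ ℤₚ, u ^⟨ s ⟩ is the limit of u ^ e over naturals e tending to s.
  -- Since u ^ pⁿ ≡ 1 (mod pⁿ), modulo pⁿ any natural e ≡ s (mod pⁿ) gives the limit.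

  exponent : ℤₚ → ℕ → ℕ
  exponent s n = (approx s n %ℕ (p ℕ.^ n)) {{ℕ.m^n≢0 p n}}

  exponent-≡ : ∀ s n → approx s n ≡ + exponent s n [mod P n ]
  exponent-≡ s n = mod (divides d (trans (cong (_- + r) e) (eq (+ r) (d * P n))))
    where
    instance _ = ℕ.m^n≢0 p n
    r = exponent s n
    d = approx s n /ℕ (p ℕ.^ n)
    e = a≡a%ℕn+[a/ℕn]*n (approx s n) (p ℕ.^ n)
    eq : ∀ x y → (x + y) - x ≡ y
    eq = solve-∀

  ^-periodic : ∀ {u} n e f → u ≡ 1ℤ [mod + p ] → + e ≡ + f [mod P n ] → u ^ e ≡ u ^ f [mod P n ]
  ^-periodic {u} n e f u≡1 e≡f =
    [ (λ e≤f → mod-sym (go e f e≤f (mod-sym e≡f))) , (λ f≤e → go f e f≤e e≡f) ]′ (ℕ.≤-total e f)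
    where
    go : ∀ a b → a ℕ.≤ b → + b ≡ + a [mod P n ] → u ^ b ≡ u ^ a [mod P n ]
    go a b a≤b b≡a = subst (λ m → u ^ m ≡ u ^ a [mod P n ]) (ℕ.m∸n+n≡m a≤b)
      (mod-trans (mod-reflexive (ℤ.^-distribˡ-+-* u (b ℕ.∸ a) a))
      (mod-trans (mod-* u^d≡1 (mod-refl {a = u ^ a})) (mod-reflexive (ℤ.*-identityˡ (u ^ a)))))
      where
      pⁿ∣d : p ℕ.^ n ℕ.∣ b ℕ.∸ a
      pⁿ∣d = ∣⇒∣ᵤ (subst (P n ∣_) (trans (ℤ.m-n≡m⊖n b a) (ℤ.⊖-≥ a≤b)) (_≡_[mod_].difference b≡a))
      k = ℕ._∣_.quotient pⁿ∣d
      u^d≡1 : u ^ (b ℕ.∸ a) ≡ 1ℤ [mod P n ]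
      u^d≡1 = mod-trans (mod-reflexive (trans (cong (u ^_) (trans (ℕ._∣_.equality pⁿ∣d) (ℕ.*-comm k (p ℕ.^ n))))
                                              (sym (^-*-assoc u (p ℕ.^ n) k))))
        (mod-trans (mod-^ k (mod-weaken (P-mono (ℕ.n≤1+n n)) (power-lift n u≡1)))
                   (mod-reflexive (trans (cong (_^ k) (1^ (p ℕ.^ n))) (1^ k))))

  infixr 8 _^⟨_⟩

  _^⟨_⟩ : 1+qℤₚ → ℤₚ → ℤₚ
  u ^⟨ s ⟩ = record { approx = λ n → approx u₀ n ^ exponent s n ; coherent = coh }
    where
    u₀ = 1+qℤₚ.value u
    u≡1 : ∀ n → approx u₀ (suc n) ≡ 1ℤ [mod + p ]
    u≡1 n = mod-trans (weaken (approx-≤ u₀ {1} {suc n} (s≤s z≤n)))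
      (mod-trans (mod-sym (weaken (approx-≤ u₀ 1≤q-exponent)))
                 (weaken (mod-weaken (P-mono 1≤q-exponent) (mod (1+qℤₚ.principal u)))))
      where
      weaken : ∀ {a b} → a ≡ b [mod P 1 ] → a ≡ b [mod + p ]
      weaken {a} {b} = subst (λ m → a ≡ b [mod m ]) P1≡p
    coh : ∀ n → approx u₀ (suc n) ^ exponent s (suc n) ≡ approx u₀ n ^ exponent s n [mod P n ]
    coh zero      = mod-P0
    coh n@(suc m) = mod-trans (mod-^ (exponent s (suc n)) (coherent u₀ n))
      (^-periodic n (exponent s (suc n)) (exponent s n) (u≡1 m)
        (mod-trans (mod-sym (mod-weaken (P-mono (ℕ.n≤1+n n)) (exponent-≡ s (suc n))))
        (mod-trans (coherent s n) (exponent-≡ s n))))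

  factor : ℤₚ → ℤ → ℤₚˣ → ℤₚ
  factor s k y = ⟨x⟩ ^⟨ -ₚ s ⟩ *ₚ ω ^ˣ k
    where open Decomposition (decompose y)

  -- partialSum v i = v 0 + ⋯ + v i

  partialSum : ∀ {n} → Vector ℤₚ n → Fin n → ℤₚ
  partialSum v zero    = v zero
  partialSum v (suc i) = v zero +ₚ partialSum (tail v) i

  module _ {r : ℕ} (s : Vector ℤₚ r) (k : Vector ℤ r) (γ : Vector ℤₚ r) where

    linear : Vector ℤₚ r → Fin r → ℤₚ
    linear x = partialSum (λ j → x j *ₚ γ j)

    Domain : Vector ℤₚ r → Set
    Domain x = ∀ i → ¬ 1 ∣ₚ linear x i

    domain? : ∀ x → Dec (Domain x)
    domain? x = Fin.all? (λ i → ¬? (P 1 ∣? approx (linear x i) 1))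

    -- ∏ᵢ ⟨yᵢ⟩^(-sᵢ) ω(yᵢ)^kᵢ with yᵢ = x₀γ₀ + ⋯ + xᵢγᵢ, extended by zero off the (open and
    -- closed) domain of integration, so that its integral over ℤₚʳ is the one over the domain.

    integrand : Vector ℤₚ r → ℤₚ
    integrand x with domain? x
    ... | yes x∈D = ∏ₚ (λ i → factor (s i) (k i) (unit (linear x i) (x∈D i)))
    ... | no  _   = 0ₚ

  fromℕˣ : ∀ c → Coprime c p → ℤₚˣ
  fromℕˣ c c⊥p = unit (fromℤ (+ c)) λ h → ℕ.nonTrivial⇒≢1 {{prime⇒nonTrivial p-prime}}
    (c⊥p (∣⇒∣ᵤ (subst (_∣ + c) P1≡p h) , ℕ.∣-refl))

  -- |x|ₚ < p⁻ⁿ; the values of |·|ₚ on ℤₚ being integral powers of p, this is |x|ₚ ≤ p⁻ⁿ⁻¹.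

  ∣_∣<p^-_ : ℤₚ → ℕ → Set
  ∣ x ∣<p^- n = suc n ∣ₚ x

  module HeytingFieldOps {c ℓ₁ ℓ₂} (F : HeytingField c ℓ₁ ℓ₂) where
    open HeytingField F public
    open HeytingCommutativeRing heytingCommutativeRing public using (commutativeRing)
    open CommutativeRing commutativeRing public using (rawRing; ring; *-monoid)
    open RawSemiringDefs (RawRing.rawSemiring rawRing) public using (_^_; sum; product)

  -- A field with a non-archimedean absolute value extending that of ℤₚ. The apartness x # y
  -- is the positive form of x ≠ y. The absolute value is given additively, |x| = p^(-v(x)) for
  -- x ≠ 0, with v(x) rational (on ℂₚ the nonzero absolute values are the rational powers of p);
  -- v-ι says that v agrees on ℤₚ with the usual valuation.

  record ValuedExtension (c ℓ₁ ℓ₂ : Level) : Set (Level.suc (c ⊔ ℓ₁ ⊔ ℓ₂)) where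
    field
      heytingField : HeytingField c ℓ₁ ℓ₂

    module K = HeytingFieldOps heytingField
    open K using (Carrier; _≈_; _#_; 0#; 1#)

    field
      ι      : ℤₚ → Carrier
      ι-homo : IsRingHomomorphism ℤₚ-rawRing K.rawRing ι
      v      : ∀ {x} → x # 0# → ℚ
      v-cong : ∀ {x y} (x#0 : x # 0#) (y#0 : y # 0#) → x ≈ y → v x#0 ≡ v y#0
      v-*    : ∀ {x y} (x#0 : x # 0#) (y#0 : y # 0#) (xy#0 : x K.* y # 0#) → v xy#0 ≡ v x#0 ℚ.+ v y#0
      v-+    : ∀ {x y} (x#0 : x # 0#) (y#0 : y # 0#) (x+y#0 : x K.+ y # 0#) → v x#0 ⊓ v y#0 ℚ.≤ v x+y#0
      v-ι    : ∀ a n → n ∣ₚ a → ¬ suc n ∣ₚ a → Σ[ ιa#0 ∈ ι a # 0# ] v ιa#0 ≡ ℚ.fromℤ (+ n)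

    -- |x| < p⁻ᵐ, which holds vacuously for x = 0. As the powers p⁻ᵐ tend to 0, they suffice
    -- as values of ε and δ.

    ‖_‖<p^-_ : Carrier → ℕ → Set _
    ‖ x ‖<p^- m = ∀ (x#0 : x # 0#) → ℚ.fromℤ (+ m) ℚ.< v x#0

    IsLimit : (ℕ → Carrier) → Carrier → Set _
    IsLimit u l = ∀ m → ∃ λ N₀ → ∀ N → N₀ ℕ.≤ N → ‖ u N K.- l ‖<p^- m

    IsCauchy : (ℕ → Carrier) → Set _
    IsCauchy u = ∀ m → ∃ λ N₀ → ∀ M N → N₀ ℕ.≤ M → N₀ ℕ.≤ N → ‖ u M K.- u N ‖<p^- m

    -- monic a x = xⁿ + Σᵢ aᵢ xⁱ

    monic : ∀ {n} → Vector Carrier n → Carrier → Carrier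
    monic {n} a x = x K.^ n K.+ K.sum (λ i → a i K.* x K.^ toℕ i)

    _∈ℚₚ : Carrier → Set _
    x ∈ℚₚ = ∃ λ n → ∃ λ a → ι (fromℤ (P n)) K.* x ≈ ι a

    AlgebraicOverℚₚ : Carrier → Set _
    AlgebraicOverℚₚ x = ∃ λ n → Σ[ a ∈ Vector Carrier n ] (∀ i → a i ∈ℚₚ) × monic a x ≈ 0#

  -- ℂₚ: complete, algebraically closed, and with the elements algebraic over ℚₚ dense, i.e. a
  -- completion of an algebraic closure of ℚₚ. These properties determine it up to an
  -- isomorphism preserving the absolute value.

  record PadicComplexNumbers (c ℓ₁ ℓ₂ : Level) : Set (Level.suc (c ⊔ ℓ₁ ⊔ ℓ₂)) where
    field
      valuedExtension : ValuedExtension c ℓ₁ ℓ₂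

    open ValuedExtension valuedExtension public
    open K using (Carrier; _≈_; 0#)

    field
      complete            : ∀ u → IsCauchy u → ∃ (IsLimit u)
      algebraicallyClosed : ∀ n (a : Vector Carrier (suc n)) → ∃ λ x → monic a x ≈ 0#
      algebraicDense      : ∀ x m → ∃ λ y → AlgebraicOverℚₚ y × ‖ x K.- y ‖<p^- m

  module Measures {a ℓ₁ ℓ₂} (ℂₚ : PadicComplexNumbers a ℓ₁ ℓ₂) where

    open PadicComplexNumbers ℂₚ
    open K using (Carrier; _≈_; _#_; 0#; 1#)

    open SetoidReasoning K.setoid
    open HeytingProperties (HeytingField.heytingCommutativeRing heytingField) using (#-congʳ; #-congˡ; invertibleˡ⇒#)
    open RingProperties K.ring using (x[y-z]≈xy-xz)

    *-cancel-# : ∀ x {y z} → x K.* y # x K.* z → y # z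
    *-cancel-# x {y} {z} h with K.#⇒invertible h
    ... | t , t*≈1 , _ = invertibleˡ⇒# (t K.* x , (begin
      (t K.* x) K.* (y K.- z)       ≈⟨ K.*-assoc t x (y K.- z) ⟩
      t K.* (x K.* (y K.- z))       ≈⟨ K.*-congˡ (x[y-z]≈xy-xz x y z) ⟩
      t K.* (x K.* y K.- x K.* z)   ≈⟨ t*≈1 ⟩
      1#                            ∎))

    ^-#1 : ∀ x n → x K.^ n # 1# → x # 1#
    ^-#1 x zero    h = ⊥-elim (K.#-irrefl K.refl h)
    ^-#1 x (suc n) h with K.#-cotrans h x
    ... | inj₁ xxⁿ#x = ^-#1 x n (*-cancel-# x (#-congˡ (K.sym (K.*-identityʳ x)) xxⁿ#x))
    ... | inj₂ x#1   = x#1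

    ^-* : ∀ x m n → (x K.^ m) K.^ n ≈ x K.^ (n ℕ.* m)
    ^-* x m n = MonoidMult.×-assocˡ K.*-monoid x n m

    ^-*′ : ∀ x m n → (x K.^ m) K.^ n ≈ x K.^ (m ℕ.* n)
    ^-*′ x m n = K.trans (^-* x m n) (K.reflexive (cong (x K.^_) (ℕ.*-comm n m)))

    1#^ : ∀ n → 1# K.^ n ≈ 1#
    1#^ zero    = K.refl
    1#^ (suc n) = K.trans (K.*-identityˡ _) (1#^ n)

    ^-cong : ∀ {x y} n → x ≈ y → x K.^ n ≈ y K.^ n
    ^-cong zero    h = K.refl
    ^-cong (suc n) h = K.*-cong h (^-cong n h)

    IsNontrivialRoot : ℕ → Carrier → Set _
    IsNontrivialRoot c ξ = ξ K.^ c ≈ 1# × ξ # 1#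

    p-th-power-nontrivial : ∀ {c ξ} → Coprime c p → IsNontrivialRoot c ξ → IsNontrivialRoot c (ξ K.^ p)
    p-th-power-nontrivial {c} {ξ} c⊥p (ξᶜ≈1 , ξ#1) = ξᵖᶜ≈1 , ξᵖ#1 (coprime-Bézout c⊥p)
      where
      ξ^c*≈1 : ∀ n → ξ K.^ (n ℕ.* c) ≈ 1#
      ξ^c*≈1 n = K.trans (K.sym (^-* ξ c n)) (K.trans (^-cong n ξᶜ≈1) (1#^ n))
      ξᵖᶜ≈1 : (ξ K.^ p) K.^ c ≈ 1#
      ξᵖᶜ≈1 = K.trans (^-*′ ξ p c) (ξ^c*≈1 p)
      ξᵖ#1 : Bézout.Identity 1 c p → ξ K.^ p # 1#
      ξᵖ#1 (Bézout.+- x y eq) = ^-#1 (ξ K.^ p) y (K.#-sym (*-cancel-# ξ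
        (#-congʳ (K.sym (K.*-identityʳ ξ)) (#-congˡ (begin
          1#                     ≈⟨ ξ^c*≈1 x ⟨
          ξ K.^ (x ℕ.* c)        ≡⟨ cong (ξ K.^_) eq ⟨
          ξ K.* ξ K.^ (y ℕ.* p)  ≈⟨ K.*-congˡ (^-* ξ p y) ⟨
          ξ K.* (ξ K.^ p) K.^ y  ∎) ξ#1))))
      ξᵖ#1 (Bézout.-+ x y eq) = ^-#1 (ξ K.^ p) y (#-congʳ (begin
          ξ                      ≈⟨ K.*-identityʳ ξ ⟨
          ξ K.* 1#               ≈⟨ K.*-congˡ (ξ^c*≈1 x) ⟨
          ξ K.* ξ K.^ (x ℕ.* c)  ≡⟨ cong (ξ K.^_) eq ⟩
          ξ K.^ (y ℕ.* p)        ≈⟨ ^-* ξ p y ⟨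
          (ξ K.^ p) K.^ y        ∎) ξ#1)

    nonvanishing : ∀ {c ξ} → Coprime c p → IsNontrivialRoot c ξ → ∀ N → 1# # ξ K.^ (p ℕ.^ N)
    nonvanishing {c} {ξ} c⊥p h zero    = K.#-sym (#-congʳ (K.sym (K.*-identityʳ ξ)) (proj₂ h))
    nonvanishing {c} {ξ} c⊥p h (suc N) = #-congˡ (^-*′ ξ p (p ℕ.^ N))
      (nonvanishing c⊥p (p-th-power-nontrivial c⊥p h) N)

    -- μ N j is the mass of j + pᴺℤₚ, for 0 ≤ j < pᴺ.

    Measure : Set a
    Measure = ℕ → ℕ → Carrier

    -- 𝔪 z N j = zʲ / (1 - z^(pᴺ)). The denominators are nonzero whenever |z - 1| ≥ 1; for the
    -- z used below this is nonvanishing.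

    𝔪 : (z : Carrier) → (∀ N → 1# # z K.^ (p ℕ.^ N)) → Measure
    𝔪 z zᵖ#1 N j = z K.^ j K.* proj₁ (K.#⇒invertible (zᵖ#1 N))

    -- A listing without repetition of the finite set { ξ | ξᶜ = 1, ξ ≠ 1 }.

    record NontrivialRoots (c : ℕ) : Set (a ⊔ ℓ₁ ⊔ ℓ₂) where
      field
        count    : ℕ
        root     : Fin count → Carrier
        isRoot   : ∀ i → IsNontrivialRoot c (root i)
        distinct : ∀ i j → i ≢ j → root i # root j
        covers   : ∀ ξ → IsNontrivialRoot c ξ → ∃ λ i → ξ ≈ root i

    𝔪̃ : ∀ {c} → NontrivialRoots c → Coprime c p → Measure
    𝔪̃ R c⊥p N j = K.sum (λ i → 𝔪 (root i) (nonvanishing c⊥p (isRoot i)) N j)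
      where open NontrivialRoots R

    -- The sum of f over {0, …, n - 1}ʳ.

    sumOverBox : ∀ r → ℕ → (Vector ℕ r → Carrier) → Carrier
    sumOverBox zero    n f = f []
    sumOverBox (suc r) n f = K.sum {n} (λ j → sumOverBox r n (λ js → f (toℕ j ∷ js)))

    -- The cell ∏ᵢ (jᵢ + pᴺℤₚ) has mass ∏ᵢ μ(jᵢ + pᴺℤₚ) and sample point (jᵢ), 0 ≤ jᵢ < pᴺ.

    riemannSum : ∀ {r} → Measure → (Vector ℤₚ r → ℤₚ) → ℕ → Carrier
    riemannSum {r} μ f N = sumOverBox r (p ℕ.^ N)
      (λ j → ι (f (λ i → fromℤ (+ j i))) K.* K.product (λ i → μ N (j i)))

    -- The integral of f over ℤₚʳ for the r-fold product of μ exists and equals I.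

    HasIntegral : ∀ {r} → Measure → (Vector ℤₚ r → ℤₚ) → Carrier → Set _
    HasIntegral μ f I = IsLimit (riemannSum μ f) I

    -- L = L_{p,r}(s; ω^k; γ; c), including the convergence of the defining integral.

    IsLValue : ∀ {r} → Vector ℤₚ r → Vector ℤ r → Vector ℤₚ r → ∀ c → Coprime c p → Carrier → Set _
    IsLValue s k γ c c⊥p L = Σ[ R ∈ NontrivialRoots c ] HasIntegral (𝔪̃ R c⊥p) (integrand s k γ) L

{-# OPTIONS --safe #-}
module Submission where

-- For natural c > 1 prime to p and 0 ≤ j < pᴺ, let 1 ≤ a ≤ c solve a pᴺ ≡ j (mod c). Summing
-- ξʲ / (1 - ξ^pᴺ) over the nontrivial c-th roots of unity ξ gives 2 𝔪̃_c(j + pᴺℤₚ) = 2a - c - 1,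
-- and modulo pᵐ this integer depends only on c modulo pᴺ⁺ᵐ. The integrand is Lipschitz in x and
-- in s, so modulo pᵐ the integral for the doubled measure is its Riemann sum over the cells of
-- radius p⁻ᵐ⁻¹, which depends only on c modulo p²ᵐ⁺¹ and on s modulo pᵐ. Hence 2ʳL is ℤₚ-valued
-- and extends to all units c, uniformly continuously in c and s, through natural representatives.

-- The obstacle is that `c` enters the measure through the set of its nontrivial roots of unity,
-- which does not vary continuously with `c`. Only after the sum over the roots is evaluated is
-- there anything to interpolate. The evaluation rests on the power sums of these roots being -1.
-- The field has an apartness and no decidable equality, so what is needed of the roots is obtained
-- in positive form, from the derivative of X^c - 1 being apart from 0 at each root. The mass itself
-- is a - (c + 1)/2. Doubling keeps it an integer whatever the parity of `c` and leaves all
-- congruences inside `ℤₚ`. The halves return only in the field, where for p = 2 each of the r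
-- coordinates costs one digit of precision. That the doubled masses add up under refinement is not
-- read off from the congruence defining them: it holds for the sums over roots and is carried back
-- along the injective map `ι`.

open import Defs
open import Level using (Level; _⊔_; 0ℓ)
open import Algebra.Apartness.Bundles using (HeytingField; HeytingCommutativeRing)
import Algebra.Apartness.Properties.HeytingCommutativeRing as HeytingProperties
open import Algebra.Bundles using (CommutativeRing; RawRing)
import Algebra.Definitions.RawSemiring as RawSemiringDefs
open import Algebra.Morphism.Structures using (IsRingHomomorphism)
open import Algebra.Structures using (IsCommutativeRing)
import Algebra.Properties.AbelianGroup as AbelianGroupProperties
import Algebra.Properties.CommutativeSemigroup as CommutativeSemigroupProperties
import Algebra.Properties.Ring as RingProperties
import Algebra.Properties.Semiring.Exp as SemiringExp
import Algebra.Properties.Semiring.Mult as SemiringMult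
import Algebra.Properties.Semiring.Sum as SemiringSum
import Algebra.Solver.Ring as Solver
open import Algebra.Solver.Ring.AlmostCommutativeRing using (fromCommutativeRing; _-Raw-AlmostCommutative⟶_)
open import Data.Empty using (⊥; ⊥-elim)
open import Data.Fin.Base using (Fin; zero; suc; toℕ)
import Data.Fin.Properties as Fin
open import Data.Integer.Base using (ℤ; +_; -[1+_]; 0ℤ; 1ℤ; -1ℤ)
import Data.Integer.Base as ℤ
import Data.Integer.DivMod as ℤ
open import Data.Integer.Divisibility.Signed using (_∣_; divides; ∣-trans; ∣ᵤ⇒∣; ∣⇒∣ᵤ; _∣?_)
import Data.Integer.Properties as ℤ
import Data.Integer.Tactic.RingSolver as ℤ
open import Data.Maybe.Base using (Maybe; just; nothing)
open import Data.Nat.Base using (ℕ; zero; suc; NonZero; _<_; s≤s; z≤n)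
import Data.Nat.Base as ℕ
open import Data.Nat.Coprimality using (Coprime)
import Data.Nat.Coprimality as ℕ
import Data.Nat.Divisibility as ℕ
import Data.Nat.DivMod as ℕ
open import Data.Nat.Primality using (Prime; prime⇒irreducible; prime⇒nonZero; prime⇒nonTrivial)
import Data.Nat.Properties as ℕ
open import Data.Product.Base using (Σ-syntax; ∃; ∃-syntax; _×_; _,_; proj₁; proj₂)
open import Data.Rational.Base using (ℚ)
import Data.Rational.Base as ℚ
import Data.Rational.Literals as ℚ
import Data.Rational.Properties as ℚ
import Data.Rational.Unnormalised.Base as ℚᵘ
import Data.Rational.Unnormalised.Properties as ℚᵘ
open import Data.Sum.Base using (_⊎_; inj₁; inj₂; [_,_]′)
open import Data.Vec.Functional using (Vector; []; _∷_; foldr; head; tail)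
open import Function.Base using (_∘_)
open import Relation.Binary.PropositionalEquality as ≡ using (_≡_; _≢_)
import Relation.Binary.Reasoning.Setoid as SetoidReasoning
open import Relation.Binary.Structures using (IsEquivalence)
open import Relation.Nullary using (¬_; yes; no)

-- Normalization of polynomial identities in a commutative ring.

-- The coefficient (a , b) stands for the integer a - b; the operations keep a or b equal to 0.

module RingSolver {c ℓ} (R : CommutativeRing c ℓ) where
  open CommutativeRing R hiding (zero)
  open RingProperties ring using (x[y-z]≈xy-xz; [y-z]x≈yx-zx; -‿distribʳ-*; -‿involutive)
  open AbelianGroupProperties +-abelianGroup using (⁻¹-∙-comm)
  open CommutativeSemigroupProperties +-commutativeSemigroup using (interchange)
  open SemiringMult semiring using (×-homo-+; ×1-homo-*) renaming (_×_ to _·_)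
  open SetoidReasoning setoid

  private
    reduce : ℕ × ℕ → ℕ × ℕ
    reduce (a , b) = a ℕ.∸ b , b ℕ.∸ a

    Coeff : RawRing 0ℓ 0ℓ
    Coeff = record
      { Carrier = ℕ × ℕ
      ; _≈_     = _≡_
      ; _+_     = λ (a , b) (c , d) → reduce (a ℕ.+ c , b ℕ.+ d)
      ; _*_     = λ (a , b) (c , d) → reduce (a ℕ.* c ℕ.+ b ℕ.* d , a ℕ.* d ℕ.+ b ℕ.* c)
      ; -_      = λ (a , b) → b , a
      ; 0#      = 0 , 0
      ; 1#      = 1 , 0
      }

    module C = RawRing Coeff

    n : ℕ → Carrier
    n a = a · 1#

    difference : ℕ × ℕ → Carrier
    difference (a , b) = n a - n b

    -- The cases 0 and 1 make the solver read the numerals 0 and 1 as 0# and 1# on the nose.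

    ⟦_⟧ : ℕ × ℕ → Carrier
    ⟦ 0 , 0 ⟧ = 0#
    ⟦ 1 , 0 ⟧ = 1#
    ⟦ x ⟧     = difference x

    ⟦⟧≈difference : ∀ x → ⟦ x ⟧ ≈ difference x
    ⟦⟧≈difference (0 , 0) = sym (-‿inverseʳ 0#)
    ⟦⟧≈difference (1 , 0) = sym (begin
      1# + 0# - 0#   ≈⟨ +-assoc 1# 0# (- 0#) ⟩
      1# + (0# - 0#) ≈⟨ +-congˡ (-‿inverseʳ 0#) ⟩
      1# + 0#        ≈⟨ +-identityʳ 1# ⟩
      1#             ∎)
    ⟦⟧≈difference (0 , suc _)           = refl
    ⟦⟧≈difference (1 , suc _)           = refl
    ⟦⟧≈difference (suc (suc _) , _)     = refl

    -‿interchange : ∀ x y z w → (x + z) - (y + w) ≈ (x - y) + (z - w)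
    -‿interchange x y z w = trans (+-congˡ (sym (⁻¹-∙-comm y w))) (interchange x z (- y) (- w))

    -‿flip : ∀ x y → - (x - y) ≈ y - x
    -‿flip x y = begin
      - (x - y)      ≈⟨ ⁻¹-∙-comm x (- y) ⟨
      - x + - - y    ≈⟨ +-comm (- x) _ ⟩
      - - y + - x    ≈⟨ +-congʳ (-‿involutive y) ⟩
      y - x          ∎

    n-distrib : ∀ a b c d → n (a ℕ.* c ℕ.+ b ℕ.* d) ≈ n a * n c + n b * n d
    n-distrib a b c d = trans (×-homo-+ 1# (a ℕ.* c) (b ℕ.* d)) (+-cong (×1-homo-* a c) (×1-homo-* b d))

    difference-cong : ∀ a b c d → a ℕ.+ d ≡ c ℕ.+ b → difference (a , b) ≈ difference (c , d)
    difference-cong a b c d e = begin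
      n a - n b                   ≈⟨ +-identityʳ _ ⟨
      (n a - n b) + 0#            ≈⟨ +-congˡ (-‿inverseʳ (n d)) ⟨
      (n a - n b) + (n d - n d)   ≈⟨ -‿interchange _ _ _ _ ⟨
      (n a + n d) - (n b + n d)   ≈⟨ +-cong cross (-‿cong (+-comm _ _)) ⟩
      (n c + n b) - (n d + n b)   ≈⟨ -‿interchange _ _ _ _ ⟩
      (n c - n d) + (n b - n b)   ≈⟨ +-congˡ (-‿inverseʳ (n b)) ⟩
      (n c - n d) + 0#            ≈⟨ +-identityʳ _ ⟩
      n c - n d                   ∎
      where
      cross : n a + n d ≈ n c + n b
      cross = trans (sym (×-homo-+ 1# a d)) (trans (reflexive (≡.cong n e)) (×-homo-+ 1# c b))

    difference-reduce : ∀ a b → difference (reduce (a , b)) ≈ difference (a , b)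
    difference-reduce a b = difference-cong (a ℕ.∸ b) (b ℕ.∸ a) a b (cross a b)
      where
      cross : ∀ a b → a ℕ.∸ b ℕ.+ b ≡ a ℕ.+ (b ℕ.∸ a)
      cross zero    zero    = ≡.refl
      cross zero    (suc b) = ≡.refl
      cross (suc a) zero    = ≡.refl
      cross (suc a) (suc b) = ≡.trans (ℕ.+-suc (a ℕ.∸ b) b) (≡.cong suc (cross a b))

    difference-+ : ∀ x y → difference (x C.+ y) ≈ difference x + difference y
    difference-+ (a , b) (c , d) = trans (difference-reduce (a ℕ.+ c) (b ℕ.+ d)) (trans
      (+-cong (×-homo-+ 1# a c) (-‿cong (×-homo-+ 1# b d))) (-‿interchange (n a) (n b) (n c) (n d)))

    difference-* : ∀ x y → difference (x C.* y) ≈ difference x * difference y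
    difference-* (a , b) (c , d) = trans (difference-reduce (a ℕ.* c ℕ.+ b ℕ.* d) (a ℕ.* d ℕ.+ b ℕ.* c)) (begin
      n (a ℕ.* c ℕ.+ b ℕ.* d) - n (a ℕ.* d ℕ.+ b ℕ.* c) ≈⟨ +-cong (n-distrib a b c d) (-‿cong (n-distrib a b d c)) ⟩
      (n a * n c + n b * n d) - (n a * n d + n b * n c) ≈⟨ -‿interchange _ _ _ _ ⟩
      (n a * n c - n a * n d) + (n b * n d - n b * n c) ≈⟨ +-cong (x[y-z]≈xy-xz _ _ _) (x[y-z]≈xy-xz _ _ _) ⟨
      n a * (n c - n d) + n b * (n d - n c)             ≈⟨ +-congˡ (*-congˡ (-‿flip (n c) (n d))) ⟨
      n a * (n c - n d) + n b * - (n c - n d)           ≈⟨ +-congˡ (-‿distribʳ-* (n b) _) ⟨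
      n a * (n c - n d) - n b * (n c - n d)             ≈⟨ [y-z]x≈yx-zx _ _ _ ⟨
      (n a - n b) * (n c - n d)                         ∎)

    morphism : Coeff -Raw-AlmostCommutative⟶ fromCommutativeRing R
    morphism = record
      { ⟦_⟧    = ⟦_⟧
      ; +-homo = λ x y → trans (⟦⟧≈difference (x C.+ y)) (trans (difference-+ x y)
                   (sym (+-cong (⟦⟧≈difference x) (⟦⟧≈difference y))))
      ; *-homo = λ x y → trans (⟦⟧≈difference (x C.* y)) (trans (difference-* x y)
                   (sym (*-cong (⟦⟧≈difference x) (⟦⟧≈difference y))))
      ; -‿homo = λ x → trans (⟦⟧≈difference (C.- x)) (trans (sym (-‿flip (n (proj₁ x)) (n (proj₂ x))))
                   (sym (-‿cong (⟦⟧≈difference x))))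
      ; 0-homo = refl
      ; 1-homo = refl
      }

    _≟_ : ∀ x y → Maybe (⟦ x ⟧ ≈ ⟦ y ⟧)
    x@(a , b) ≟ y@(c , d) with a ℕ.+ d ℕ.≟ c ℕ.+ b
    ... | no  _ = nothing
    ... | yes e = just (trans (⟦⟧≈difference x) (trans (difference-cong a b c d e) (sym (⟦⟧≈difference y))))

  open Solver Coeff (fromCommutativeRing R) morphism _≟_ public
    using (solve; con; _:=_; _:+_; _:*_; _:-_; :-_; Polynomial)

  :0 :1 : ∀ {m} → Polynomial m
  :0 = con (0 , 0)
  :1 = con (1 , 0)

-- Splitting of separable monic polynomials into pairwise apart roots.

-- A monic polynomial of degree n is the vector of its n lower coefficients, in increasing order.

module MonicPolynomials {c ℓ₁ ℓ₂} (F : HeytingField c ℓ₁ ℓ₂) where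
  open HeytingField F hiding (zero; _-_)
  open HeytingCommutativeRing heytingCommutativeRing using (commutativeRing)
  open CommutativeRing commutativeRing using (rawRing; semiring; _-_)
  open HeytingProperties heytingCommutativeRing using (#-congʳ; invertibleˡ⇒#; x-0≈x)
  open RawSemiringDefs (RawRing.rawSemiring rawRing) using (_^_)
  open SemiringMult semiring using (×-congʳ) renaming (_×_ to _·_)
  open SemiringSum semiring using (sum; sum-cong-≋; sum-replicate-zero)
  open RingSolver commutativeRing
  open SetoidReasoning setoid

  #0⇒inverse : ∀ {x} → x # 0# → ∃ λ y → y * x ≈ 1#
  #0⇒inverse {x} x#0 with #⇒invertible x#0
  ... | y , y*≈1 , _ = y , trans (*-congˡ (sym (x-0≈x x))) y*≈1

  inverse⇒#0 : ∀ {x} y → y * x ≈ 1# → x # 0#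
  inverse⇒#0 {x} y e = invertibleˡ⇒# (y , trans (*-congˡ (x-0≈x x)) e)

  *-#0ˡ : ∀ {x y} → x * y # 0# → x # 0#
  *-#0ˡ {x} {y} h with #0⇒inverse h
  ... | z , e = inverse⇒#0 (z * y) (trans (solve 3 (λ z y x → z :* y :* x := z :* (x :* y)) refl z y x) e)

  *-#0ʳ : ∀ {x y} → x * y # 0# → y # 0#
  *-#0ʳ {x} {y} h = *-#0ˡ (#-congʳ (*-comm x y) h)

  *-cancel-#0 : ∀ {x y} → x # 0# → x * y ≈ 0# → y ≈ 0#
  *-cancel-#0 {x} {y} x#0 xy≈0 with #0⇒inverse x#0
  ... | z , e = begin
    y           ≈⟨ *-identityˡ y ⟨
    1# * y      ≈⟨ *-congʳ e ⟨
    z * x * y   ≈⟨ *-assoc z x y ⟩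
    z * (x * y) ≈⟨ *-congˡ xy≈0 ⟩
    z * 0#      ≈⟨ zeroʳ z ⟩
    0#          ∎

  -#0⇒# : ∀ {x y} → x - y # 0# → x # y
  -#0⇒# {x} {y} h = invertibleˡ⇒# (#0⇒inverse h)

  #⇒-#0 : ∀ {x y} → x # y → x - y # 0#
  #⇒-#0 {x} {y} h with #⇒invertible h
  ... | z , e , _ = inverse⇒#0 z e

  -≈0⇒≈ : ∀ {x y} → x - y ≈ 0# → x ≈ y
  -≈0⇒≈ {x} {y} h = begin
    x         ≈⟨ solve 2 (λ x y → x := (x :- y) :+ y) refl x y ⟩
    x - y + y ≈⟨ +-congʳ h ⟩
    0# + y    ≈⟨ +-identityˡ y ⟩
    y         ∎

  +-#0⇒⊎ : ∀ {x y} → x + y # 0# → x # 0# ⊎ y # 0#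
  +-#0⇒⊎ {x} {y} h with #-cotrans h y
  ... | inj₂ y#0    = inj₂ y#0
  ... | inj₁ x+y#y = inj₁ (#-congʳ (solve 2 (λ x y → (x :+ y) :- y := x) refl x y) (#⇒-#0 x+y#y))

  1#^ : ∀ n → 1# ^ n ≈ 1#
  1#^ zero    = refl
  1#^ (suc n) = trans (*-identityˡ _) (1#^ n)

  ·-zeroʳ : ∀ n → n · 0# ≈ 0#
  ·-zeroʳ zero    = refl
  ·-zeroʳ (suc n) = trans (+-identityˡ _) (·-zeroʳ n)

  eval : ∀ {n} → Vector Carrier n → Carrier → Carrier
  eval {zero}  a x = 1#
  eval {suc n} a x = head a + x * eval (tail a) x

  derivative : ∀ {n} → Vector Carrier n → Carrier → Carrier
  derivative {zero}  a x = 0#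
  derivative {suc n} a x = eval (tail a) x + x * derivative (tail a) x

  -- Horner's scheme for division by X - x; the remainder, not recorded here, is `eval a x`.
  quotient : ∀ {n} → Vector Carrier (suc n) → Carrier → Vector Carrier n
  quotient {zero}  a x = []
  quotient {suc n} a x = eval (tail a) x ∷ quotient (tail a) x

  coefficient : ∀ {n} → ℕ → Vector Carrier n → Carrier
  coefficient {zero}  zero    a = 1#
  coefficient {zero}  (suc k) a = 0#
  coefficient {suc n} zero    a = head a
  coefficient {suc n} (suc k) a = coefficient k (tail a)

  -- Evaluates the polynomial part of a(X) / Xᵏ.

  evalDrop : ∀ {n} → ℕ → Vector Carrier n → Carrier → Carrier
  evalDrop         zero    a x = eval a x
  evalDrop {zero}  (suc k) a x = 0#
  evalDrop {suc n} (suc k) a x = evalDrop k (tail a) x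

  division : ∀ {n} (a : Vector Carrier (suc n)) x y →
             eval a y ≈ (y - x) * eval (quotient a x) y + eval a x
  division {zero}  a x y =
    solve 3 (λ a x y → a :+ y :* :1 := (y :- x) :* :1 :+ (a :+ x :* :1)) refl (head a) x y
  division {suc n} a x y = begin
    head a + y * eval (tail a) y                       ≈⟨ +-congˡ (*-congˡ (division (tail a) x y)) ⟩
    head a + y * ((y - x) * q + r)                     ≈⟨ solve 5 (λ y x r q a → a :+ y :* ((y :- x) :* q :+ r) :=
                                                            (y :- x) :* (r :+ y :* q) :+ (a :+ x :* r)) refl y x r q (head a) ⟩
    (y - x) * (r + y * q) + (head a + x * r)           ∎
    where
    q = eval (quotient (tail a) x) y
    r = eval (tail a) x

  -- The product rule applied to a(Y) = (Y - x) q(Y) + a(x), with x held fixed.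
  derivative-quotient : ∀ {n} (a : Vector Carrier (suc n)) x y →
    derivative a y ≈ eval (quotient a x) y + (y - x) * derivative (quotient a x) y
  derivative-quotient {zero}  a x y =
    solve 2 (λ x y → :1 :+ y :* :0 := :1 :+ (y :- x) :* :0) refl x y
  derivative-quotient {suc n} a x y = begin
    eval (tail a) y + y * derivative (tail a) y        ≈⟨ +-cong (division (tail a) x y) (*-congˡ (derivative-quotient (tail a) x y)) ⟩
    ((y - x) * q + r) + y * (q + (y - x) * q′)         ≈⟨ solve 5 (λ y x r q q′ → ((y :- x) :* q :+ r) :+ y :* (q :+ (y :- x) :* q′) :=
                                                            (r :+ y :* q) :+ (y :- x) :* (q :+ y :* q′)) refl y x r q q′ ⟩
    (r + y * q) + (y - x) * (q + y * q′)               ∎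
    where
    q = eval (quotient (tail a) x) y
    q′ = derivative (quotient (tail a) x) y
    r = eval (tail a) x

  -- In a(Y) = Y q(Y) - x q(Y) + a(x) the constant contributes nothing to the polynomial part after
  -- division by Y^(k+1), and the first term becomes q(Y) / Y^k.
  evalDrop-quotient : ∀ {n} k (a : Vector Carrier (suc n)) x y →
    evalDrop (suc k) a y ≈ evalDrop k (quotient a x) y - x * evalDrop (suc k) (quotient a x) y
  evalDrop-quotient {zero} zero    a x y = solve 1 (λ x → :1 := :1 :- x :* :0) refl x
  evalDrop-quotient {zero} (suc k) a x y = solve 1 (λ x → :0 := :0 :- x :* :0) refl x
  evalDrop-quotient {suc n} zero   a x y = trans (division (tail a) x y)
    (solve 4 (λ y x r q → (y :- x) :* q :+ r := (r :+ y :* q) :- x :* q) refl y x _ _)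
  evalDrop-quotient {suc n} (suc k) a x y = evalDrop-quotient k (tail a) x y

  coefficient-quotient : ∀ {n} k (a : Vector Carrier (suc n)) x →
    coefficient k (quotient a x) ≈ evalDrop (suc k) a x
  coefficient-quotient {zero}  zero    a x = refl
  coefficient-quotient {zero}  (suc k) a x = refl
  coefficient-quotient {suc n} zero    a x = refl
  coefficient-quotient {suc n} (suc k) a x = coefficient-quotient k (tail a) x

  evalDrop-suc : ∀ {n} k (a : Vector Carrier n) x → evalDrop k a x ≈ coefficient k a + x * evalDrop (suc k) a x
  evalDrop-suc {zero}  zero    a x = solve 1 (λ x → :1 := :1 :+ x :* :0) refl x
  evalDrop-suc {zero}  (suc k) a x = solve 1 (λ x → :0 := :0 :+ x :* :0) refl x
  evalDrop-suc {suc n} zero    a x = refl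
  evalDrop-suc {suc n} (suc k) a x = evalDrop-suc k (tail a) x

  -- Comparison of the coefficients of X^(k+1) in a(X) = (X - x) q(X) + a(x).
  coefficient-suc : ∀ {n} k (a : Vector Carrier (suc n)) x →
    coefficient (suc k) a ≈ coefficient k (quotient a x) - x * coefficient (suc k) (quotient a x)
  coefficient-suc k a x = begin
    coefficient (suc k) a
      ≈⟨ solve 3 (λ c x d → c := (c :+ x :* d) :- x :* d) refl _ x (evalDrop (suc (suc k)) a x) ⟩
    (coefficient (suc k) a + x * evalDrop (suc (suc k)) a x) - x * evalDrop (suc (suc k)) a x
      ≈⟨ +-cong (evalDrop-suc (suc k) a x) (-‿cong (*-congˡ (coefficient-quotient (suc k) a x))) ⟨
    evalDrop (suc k) a x - x * coefficient (suc k) (quotient a x)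
      ≈⟨ +-congʳ (coefficient-quotient k a x) ⟨
    coefficient k (quotient a x) - x * coefficient (suc k) (quotient a x)  ∎

  -- The positive form of having only simple roots; it is the source of all apartness between roots.
  Separable : ∀ {n} → Vector Carrier n → Set _
  Separable a = ∀ y → eval a y ≈ 0# → derivative a y # 0#

  -- powerSums is Newton's identity in the form a′(X) = Σᵢ a(X) / (X - xᵢ), read coefficientwise.

  record Splitting {n} (a : Vector Carrier n) : Set (c ⊔ ℓ₁ ⊔ ℓ₂) where
    field
      root      : Vector Carrier n
      isRoot    : ∀ i → eval a (root i) ≈ 0#
      distinct  : ∀ i j → i ≢ j → root i # root j
      covers    : ∀ ξ → eval a ξ ≈ 0# → ∃ λ i → ξ ≈ root i
      powerSums : ∀ k → sum (λ i → evalDrop k a (root i)) ≈ k · coefficient k a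

  eval-quotient⇒eval : ∀ {n} (a : Vector Carrier (suc n)) {x} → eval a x ≈ 0# →
                       ∀ y → eval a y ≈ (y - x) * eval (quotient a x) y
  eval-quotient⇒eval a {x} ax≈0 y = begin
    eval a y                                    ≈⟨ division a x y ⟩
    (y - x) * eval (quotient a x) y + eval a x  ≈⟨ +-congˡ ax≈0 ⟩
    (y - x) * eval (quotient a x) y + 0#        ≈⟨ +-identityʳ _ ⟩
    (y - x) * eval (quotient a x) y             ∎

  module _ {n : ℕ} (a : Vector Carrier (suc n)) (separable : Separable a) {x : Carrier} (ax≈0 : eval a x ≈ 0#) where

    private
      b : Vector Carrier n
      b = quotient a x

    quotient-root : ∀ {y} → eval b y ≈ 0# → eval a y ≈ 0#
    quotient-root by≈0 = trans (eval-quotient⇒eval a ax≈0 _) (trans (*-congˡ by≈0) (zeroʳ _))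

    -- In a′(y) = q(y) + (y - x) q′(y) the first term vanishes at a root of q. Both factors of the
    -- product are then apart from 0: one makes the quotient separable again, the other keeps its
    -- roots apart from `x`.
    quotient-derivative : ∀ {y} → eval b y ≈ 0# → (y - x) * derivative b y # 0#
    quotient-derivative {y} by≈0 = #-congʳ
      (trans (derivative-quotient a x y) (trans (+-congʳ by≈0) (+-identityˡ _)))
      (separable y (quotient-root by≈0))

    quotient-separable : Separable b
    quotient-separable y by≈0 = *-#0ʳ (quotient-derivative by≈0)

    quotient-root-# : ∀ {y} → eval b y ≈ 0# → y # x
    quotient-root-# by≈0 = -#0⇒# (*-#0ˡ (quotient-derivative by≈0))

    -- In a Heyting field (y - x) q(y) ≈ 0 does not tell which factor vanishes. Separability
    -- decides: one summand of a′(y) = q(y) + (y - x) q′(y) is apart from 0, which makes q(y) or y -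
    -- x cancellable.
    root-cases : ∀ {y} → eval a y ≈ 0# → y ≈ x ⊎ eval b y ≈ 0#
    root-cases {y} ay≈0 with +-#0⇒⊎ (#-congʳ (derivative-quotient a x y) (separable y ay≈0))
    ... | inj₁ by#0 = inj₁ (-≈0⇒≈ (*-cancel-#0 by#0
                        (trans (*-comm _ _) (trans (sym (eval-quotient⇒eval a ax≈0 y)) ay≈0))))
    ... | inj₂ h    = inj₂ (*-cancel-#0 (*-#0ˡ h) (trans (sym (eval-quotient⇒eval a ax≈0 y)) ay≈0))

    consSplitting : Splitting b → Splitting a
    consSplitting S = record
      { root = x ∷ root
      ; isRoot = λ { zero → ax≈0 ; (suc i) → quotient-root (isRoot i) }
      ; distinct = λ { zero zero i≢j → ⊥-elim (i≢j ≡.refl)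
                     ; zero (suc j) _ → #-sym (quotient-root-# (isRoot j))
                     ; (suc i) zero _ → quotient-root-# (isRoot i)
                     ; (suc i) (suc j) i≢j → distinct i j (i≢j ∘ ≡.cong suc) }
      ; covers = λ ξ aξ≈0 → [ (λ ξ≈x → zero , ξ≈x)
                            , (λ bξ≈0 → let (i , e) = covers ξ bξ≈0 in suc i , e) ]′ (root-cases aξ≈0)
      ; powerSums = sums
      }
      where
      open Splitting S
      ·-linear : ∀ k y z → k · y - x * (k · z) ≈ k · (y - x * z)
      ·-linear zero    y z = solve 1 (λ x → :0 :- x :* :0 := :0) refl x
      ·-linear (suc k) y z = trans
        (solve 5 (λ y ky x z kz → (y :+ ky) :- x :* (z :+ kz) := (y :- x :* z) :+ (ky :- x :* kz)) refl y (k · y) x z (k · z))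
        (+-congˡ (·-linear k y z))
      *-sum : ∀ {m} z (t u : Vector Carrier m) → sum (λ i → t i - z * u i) ≈ sum t - z * sum u
      *-sum {zero}  z t u = solve 1 (λ z → :0 := :0 :- z :* :0) refl z
      *-sum {suc m} z t u = trans (+-congˡ (*-sum z (tail t) (tail u)))
        (solve 5 (λ t T z u U → (t :- z :* u) :+ (T :- z :* U) := (t :+ T) :- z :* (u :+ U)) refl (head t) (sum (tail t)) z (head u) (sum (tail u)))
      sums : ∀ k → sum (λ i → evalDrop k a ((x ∷ root) i)) ≈ k · coefficient k a
      sums zero    = trans (+-cong ax≈0 (trans (sum-cong-≋ {n} (λ i → quotient-root (isRoot i)))
                       (sum-replicate-zero n))) (+-identityˡ 0#)
      -- The new root contributes the k-th coefficient of `b`, raising its multiplicity from k to k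
      -- + 1; the other roots contribute the identities for `b` at k and at k + 1.
      sums (suc k) = begin
        evalDrop (suc k) a x + sum (λ i → evalDrop (suc k) a (root i))
          ≈⟨ +-cong (sym (coefficient-quotient k a x)) (sum-cong-≋ {n} (λ i → evalDrop-quotient k a x (root i))) ⟩
        coefficient k b + sum (λ i → evalDrop k b (root i) - x * evalDrop (suc k) b (root i))
          ≈⟨ +-congˡ (*-sum x (λ i → evalDrop k b (root i)) (λ i → evalDrop (suc k) b (root i))) ⟩
        coefficient k b + (sum (λ i → evalDrop k b (root i)) - x * sum (λ i → evalDrop (suc k) b (root i)))
          ≈⟨ +-congˡ (+-cong (powerSums k) (-‿cong (*-congˡ (powerSums (suc k))))) ⟩
        coefficient k b + (k · coefficient k b - x * (suc k · coefficient (suc k) b))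
          ≈⟨ +-assoc _ _ _ ⟨
        suc k · coefficient k b - x * (suc k · coefficient (suc k) b)
          ≈⟨ ·-linear (suc k) _ _ ⟩
        suc k · (coefficient k b - x * coefficient (suc k) b)
          ≈⟨ ×-congʳ (suc k) (coefficient-suc k a x) ⟨
        suc k · coefficient (suc k) a ∎

  split : (∀ n (a : Vector Carrier (suc n)) → ∃ λ x → eval a x ≈ 0#) →
          ∀ n (a : Vector Carrier n) → Separable a → Splitting a
  split closed zero    a sep = record
    { root      = []
    ; isRoot    = λ ()
    ; distinct  = λ ()
    -- If 1 ≈ 0, then 0 is a root of the constant polynomial 1, and separability would set its
    -- derivative 0 apart from 0.
    ; covers    = λ _ 1≈0 → ⊥-elim (#-irrefl refl (sep 0# 1≈0))
    ; powerSums = λ { zero → refl ; (suc k) → sym (·-zeroʳ (suc k)) }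
    }
  split closed (suc n) a sep with closed n a
  ... | x , ax≈0 = consSplitting a sep ax≈0 (split closed n (quotient a x) (quotient-separable a sep ax≈0))

-- Weighted sums over boxes and their refinement.

module RawBoxSums {a} {A : Set a} (_+_ _*_ : A → A → A) (0# : A) where

  -- Built from the bare operations, so that one and the same element of `ℤₚ` can be compared modulo
  -- every power of p.
  rangeSum : ∀ n → (ℕ → A) → A
  rangeSum n f = foldr _+_ 0# {n} (λ j → f (toℕ j))

  weightedSum : ∀ r → ℕ → (ℕ → A) → (Vector ℕ r → A) → A
  weightedSum zero    n w f = f []
  weightedSum (suc r) n w f = rangeSum n (λ j → w j * weightedSum r n w (λ js → f (j ∷ js)))

module BoxSums {c ℓ} {A : Set c} {_≈_ : A → A → Set ℓ} {_+_ _*_ : A → A → A} { -_ : A → A} {0# 1# : A}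
               (isCommutativeRing : IsCommutativeRing _≈_ _+_ _*_ -_ 0# 1#) where
  private
    ring : CommutativeRing c ℓ
    ring = record { isCommutativeRing = isCommutativeRing }

  open CommutativeRing ring
    using (refl; sym; trans; reflexive; setoid; semiring; +-identityˡ; +-assoc; +-cong; +-congˡ; *-cong; *-congˡ; *-congʳ)
  open SemiringSum semiring using (sum-cong-≋; *-distribʳ-sum; ∑-comm)
  open RawBoxSums _+_ _*_ 0# public
  open SetoidReasoning setoid

  rangeSum-cong : ∀ n {f g : ℕ → A} → (∀ j → j < n → f j ≈ g j) → rangeSum n f ≈ rangeSum n g
  rangeSum-cong n h = sum-cong-≋ {n} (λ j → h (toℕ j) (Fin.toℕ<n j))

  rangeSum-+ : ∀ m n (f : ℕ → A) → rangeSum (m ℕ.+ n) f ≈ (rangeSum m f + rangeSum n (λ j → f (m ℕ.+ j)))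
  rangeSum-+ zero    n f = sym (+-identityˡ _)
  rangeSum-+ (suc m) n f = trans (+-congˡ (rangeSum-+ m n (f ∘ suc))) (sym (+-assoc _ _ _))

  rangeSum-* : ∀ m n (f : ℕ → A) → rangeSum (m ℕ.* n) f ≈ rangeSum m (λ i → rangeSum n (λ j → f (j ℕ.+ i ℕ.* n)))
  rangeSum-* zero    n f = refl
  rangeSum-* (suc m) n f = begin
    rangeSum (n ℕ.+ m ℕ.* n) f
      ≈⟨ rangeSum-+ n (m ℕ.* n) f ⟩
    rangeSum n f + rangeSum (m ℕ.* n) (λ j → f (n ℕ.+ j))
      ≈⟨ +-cong (rangeSum-cong n (λ j _ → reflexive (≡.cong f (≡.sym (ℕ.+-identityʳ j)))))
                (trans (rangeSum-* m n (λ j → f (n ℕ.+ j))) (rangeSum-cong m (λ i _ → rangeSum-cong n (λ j _ →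
                  reflexive (≡.cong f (shift j (i ℕ.* n))))))) ⟩
    rangeSum (suc m) (λ i → rangeSum n (λ j → f (j ℕ.+ i ℕ.* n))) ∎
    where
    shift : ∀ j k → n ℕ.+ (j ℕ.+ k) ≡ j ℕ.+ (n ℕ.+ k)
    shift j k = ≡.trans (≡.sym (ℕ.+-assoc n j k)) (≡.trans (≡.cong (ℕ._+ k) (ℕ.+-comm n j)) (ℕ.+-assoc j n k))

  weightedSum-cong : ∀ r n {w w′ : ℕ → A} {f f′ : Vector ℕ r → A} → (∀ j → j < n → w j ≈ w′ j) → (∀ js → f js ≈ f′ js) →
                     weightedSum r n w f ≈ weightedSum r n w′ f′
  weightedSum-cong zero    n w≈w′ f≈f′ = f≈f′ []
  weightedSum-cong (suc r) n w≈w′ f≈f′ = rangeSum-cong n (λ j j<n →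
    *-cong (w≈w′ j j<n) (weightedSum-cong r n w≈w′ (λ js → f≈f′ (j ∷ js))))

  module _ {m n : ℕ} {w w′ : ℕ → A}
           (additive : ∀ j → j < n → w j ≈ rangeSum m (λ i → w′ (j ℕ.+ i ℕ.* n)))
           {ℓ′} (_∼_ : ℕ → ℕ → Set ℓ′) (∼-refl : ∀ j → j ∼ j) (∼-shift : ∀ j i → (j ℕ.+ i ℕ.* n) ∼ j) where

    -- The fine indices are j + i n. The summand does not distinguish them for varying i, so the sum
    -- over i falls on the fine weights alone and gives the coarse weight; this is done one
    -- coordinate at a time.
    weightedSum-refine : ∀ r (f : Vector ℕ r → A) →
      (∀ js js′ → (∀ i → js i ∼ js′ i) → f js ≈ f js′) →
      weightedSum r (m ℕ.* n) w′ f ≈ weightedSum r n w f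
    weightedSum-refine zero    f f-resp = refl
    weightedSum-refine (suc r) f f-resp = begin
      rangeSum (m ℕ.* n) (λ j → w′ j * weightedSum r (m ℕ.* n) w′ (λ js → f (j ∷ js)))
        ≈⟨ rangeSum-cong (m ℕ.* n) (λ j _ → *-congˡ {w′ j} (weightedSum-refine r (λ js → f (j ∷ js))
             (λ js js′ h → f-resp (j ∷ js) (j ∷ js′) (λ { zero → ∼-refl j ; (suc i) → h i })))) ⟩
      rangeSum (m ℕ.* n) (λ j → w′ j * G j)
        ≈⟨ rangeSum-* m n (λ j → w′ j * G j) ⟩
      rangeSum m (λ i → rangeSum n (λ j → w′ (j ℕ.+ i ℕ.* n) * G (j ℕ.+ i ℕ.* n)))
        ≈⟨ ∑-comm {m} {n} _ ⟩
      rangeSum n (λ j → rangeSum m (λ i → w′ (j ℕ.+ i ℕ.* n) * G (j ℕ.+ i ℕ.* n)))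
        ≈⟨ rangeSum-cong n (λ j _ → rangeSum-cong m (λ i _ → *-congˡ {w′ (j ℕ.+ i ℕ.* n)} (G-shift j i))) ⟩
      rangeSum n (λ j → rangeSum m (λ i → w′ (j ℕ.+ i ℕ.* n) * G j))
        ≈⟨ rangeSum-cong n (λ j j<n → trans (*-congʳ (additive j j<n)) (*-distribʳ-sum {m} (G j) (λ i → w′ (j ℕ.+ toℕ i ℕ.* n)))) ⟨
      rangeSum n (λ j → w j * G j) ∎
      where
      G : ℕ → A
      G j = weightedSum r n w (λ js → f (j ∷ js))
      G-shift : ∀ j i → G (j ℕ.+ i ℕ.* n) ≈ G j
      G-shift j i = weightedSum-cong r n (λ _ _ → refl) (λ js →
        f-resp _ _ (λ { zero → ∼-shift j i ; (suc k) → ∼-refl (js k) }))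

-- Congruences modulo powers of p and the Lipschitz bound for the integrand.

module PadicCongruences (p : ℕ) (p-prime : Prime p) where
  open Padic p p-prime

  private instance
    p≢0 : NonZero p
    p≢0 = prime⇒nonZero p-prime

  infix 4 _≈[_]_

  record _≈[_]_ (x : ℤₚ) (m : ℕ) (y : ℤₚ) : Set where
    constructor congruent
    field approx-mod : approx x m ≡ approx y m [mod P m ]

  open _≈[_]_ public

  ≈[0] : ∀ {x y} → x ≈[ 0 ] y
  ≈[0] = congruent mod-P0

  ≈[]-refl : ∀ {m x} → x ≈[ m ] x
  ≈[]-refl = congruent mod-refl

  ≈[]-lower : ∀ {m n x y} → m ℕ.≤ n → x ≈[ n ] y → x ≈[ m ] y
  ≈[]-lower {x = x} {y} m≤n (congruent h) = congruent
    (mod-trans (mod-sym (approx-≤ x m≤n)) (mod-trans (mod-weaken (P-mono m≤n) h) (approx-≤ y m≤n)))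

  -- The ring of integers modulo p^m, with carrier `ℤₚ` and a coarser equality, so that reduction is
  -- the identity map.
  isCommutativeRing : ∀ m → IsCommutativeRing (λ x y → x ≈[ m ] y) _+ₚ_ _*ₚ_ -ₚ_ 0ₚ 1ₚ
  isCommutativeRing m = record
    { isRing = record
      { +-isAbelianGroup = record
        { isGroup = record
          { isMonoid = record
            { isSemigroup = record
              { isMagma = record
                { isEquivalence = ≈-equiv
                ; ∙-cong = λ h k → congruent (mod-+ (approx-mod h) (approx-mod k)) }
              ; assoc = λ x y z → exact (ℤ.+-assoc (at x) (at y) (at z)) }
            ; identity = (λ x → exact (ℤ.+-identityˡ (at x))) , (λ x → exact (ℤ.+-identityʳ (at x))) }
          ; inverse = (λ x → exact (ℤ.+-inverseˡ (at x))) , (λ x → exact (ℤ.+-inverseʳ (at x)))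
          ; ⁻¹-cong = λ h → congruent (mod-neg (approx-mod h)) }
        ; comm = λ x y → exact (ℤ.+-comm (at x) (at y)) }
      ; *-cong = λ h k → congruent (mod-* (approx-mod h) (approx-mod k))
      ; *-assoc = λ x y z → exact (ℤ.*-assoc (at x) (at y) (at z))
      ; *-identity = (λ x → exact (ℤ.*-identityˡ (at x))) , (λ x → exact (ℤ.*-identityʳ (at x)))
      ; distrib = (λ x y z → exact (ℤ.*-distribˡ-+ (at x) (at y) (at z)))
                , (λ x y z → exact (ℤ.*-distribʳ-+ (at x) (at y) (at z))) }
    ; *-comm = λ x y → exact (ℤ.*-comm (at x) (at y)) }
    where
    at : ℤₚ → ℤ
    at x = approx x m
    exact : ∀ {x y} → at x ≡ at y → x ≈[ m ] y
    exact e = congruent (mod-reflexive e)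
    ≈-equiv : IsEquivalence (λ x y → x ≈[ m ] y)
    ≈-equiv = record
      { refl  = congruent mod-refl
      ; sym   = λ h → congruent (mod-sym (approx-mod h))
      ; trans = λ h k → congruent (mod-trans (approx-mod h) (approx-mod k)) }

  quotientRing : ℕ → CommutativeRing 0ℓ 0ℓ
  quotientRing m = record { isCommutativeRing = isCommutativeRing m }

  module Mod (m : ℕ) = CommutativeRing (quotientRing m)

  ≈[]-sym : ∀ {m x y} → x ≈[ m ] y → y ≈[ m ] x
  ≈[]-sym {m} = Mod.sym m

  ≈[]-trans : ∀ {m x y z} → x ≈[ m ] y → y ≈[ m ] z → x ≈[ m ] z
  ≈[]-trans {m} = Mod.trans m

  ≈[]⇒∣ : ∀ {m x y} → x ≈[ m ] y → m ∣ₚ x -ₚ y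
  ≈[]⇒∣ (congruent (mod h)) = h

  ∣⇒≈[] : ∀ {m x y} → m ∣ₚ x -ₚ y → x ≈[ m ] y
  ∣⇒≈[] h = congruent (mod h)

  inverse-cong : ∀ {m} (u w : ℤₚˣ) → value u ≈[ m ] value w → inverse u ≈[ m ] inverse w
  inverse-cong {m} u w (congruent h) =
    congruent (*ₚ-inverse-unique h (approx-≡ (inverseʳ u) m) (approx-≡ (inverseʳ w) m))

  ^ₚ-cong : ∀ {m x y} n → x ≈[ m ] y → x ^ₚ n ≈[ m ] y ^ₚ n
  ^ₚ-cong {m} {x} {y} n (congruent h) = congruent
    (≡.subst₂ (λ a b → a ≡ b [mod P m ]) (≡.sym (approx-^ x n m)) (≡.sym (approx-^ y n m)) (mod-^ n h))

  ^ˣ-cong : ∀ {m} (u w : ℤₚˣ) k → value u ≈[ m ] value w → inverse u ≈[ m ] inverse w → u ^ˣ k ≈[ m ] w ^ˣ k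
  ^ˣ-cong u w (+ n)    h k = ^ₚ-cong {x = value u} {value w} n h
  ^ˣ-cong u w -[1+ n ] h k = ^ₚ-cong {x = inverse u} {inverse w} (suc n) k

  ∏ₚ-cong : ∀ {m n} (t u : Vector ℤₚ n) → (∀ i → t i ≈[ m ] u i) → ∏ₚ t ≈[ m ] ∏ₚ u
  ∏ₚ-cong {n = zero}  t u h = ≈[]-refl
  ∏ₚ-cong {n = suc n} t u h = congruent (mod-* (approx-mod (h zero)) (approx-mod (∏ₚ-cong (tail t) (tail u) (h ∘ suc))))

  partialSum-cong : ∀ {m n} (t u : Vector ℤₚ n) → (∀ i → t i ≈[ m ] u i) →
                    ∀ i → partialSum t i ≈[ m ] partialSum u i
  partialSum-cong t u h zero    = h zero
  partialSum-cong t u h (suc i) =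
    congruent (mod-+ (approx-mod (h zero)) (approx-mod (partialSum-cong (tail t) (tail u) (h ∘ suc) i)))

  -- The base `w` is 1 modulo p, so its powers modulo p^m see the exponent only modulo p^m. The case
  -- m = 0 is separate because the 0-th approximation says nothing about the residue modulo p.
  ^⟨⟩-cong : ∀ {m u w s t} → 1+qℤₚ.value u ≈[ m ] 1+qℤₚ.value w → s ≈[ m ] t → u ^⟨ s ⟩ ≈[ m ] w ^⟨ t ⟩
  ^⟨⟩-cong {zero}                      h k = ≈[0]
  ^⟨⟩-cong {m@(suc _)} {u} {w} {s} {t} h k = congruent (mod-trans (mod-^ (exponent s m) (approx-mod h))
    (^-periodic m (exponent s m) (exponent t m) w≡1
      (mod-trans (mod-sym (exponent-≡ s m)) (mod-trans (approx-mod k) (exponent-≡ t m)))))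
    where
    w₀ = 1+qℤₚ.value w
    to-p : ∀ {a b} → a ≡ b [mod P 1 ] → a ≡ b [mod + p ]
    to-p {a} {b} = ≡.subst (λ n → a ≡ b [mod n ]) P1≡p
    w≡1 : approx w₀ m ≡ 1ℤ [mod + p ]
    w≡1 = to-p (mod-trans (approx-≤ w₀ (s≤s z≤n)) (mod-trans (mod-sym (approx-≤ w₀ 1≤q-exponent))
      (mod-weaken (P-mono 1≤q-exponent) (mod (1+qℤₚ.principal w)))))

  module D {x} (d : Decomposition x) = Decomposition d

  record _≈ᵈ[_]_ {x y} (d : Decomposition x) (m : ℕ) (e : Decomposition y) : Set where
    field
      ω-cong  : value (D.ω d) ≈[ m ] value (D.ω e)
      ⟨⟩-cong : 1+qℤₚ.value (D.⟨x⟩ d) ≈[ m ] 1+qℤₚ.value (D.⟨x⟩ e)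

  -- For p = 2 the sign ω(x) depends on x modulo 4, hence the loss of one digit at the level m = 1.

  decompose-cong : ∀ {m} u w → value u ≈[ suc (suc m) ] value w → decompose u ≈ᵈ[ suc m ] decompose w
  decompose-cong {m} u w h with q-cases
  ... | inj₂ (p≢2 , q≡) = record
    { ω-cong = congruent (mod-^ (p ℕ.^ suc m) (approx-mod h₁))
    ; ⟨⟩-cong = congruent (mod-* (approx-mod h₁) (mod-^ (p ℕ.^ suc m) (approx-mod (inverse-cong u w h₁)))) }
    where
    h₁ : value u ≈[ suc m ] value w
    h₁ = ≈[]-lower (ℕ.n≤1+n _) h
  ... | inj₁ (p≡2 , q≡) with P 2 ∣? approx (value u) 2 ℤ.- 1ℤ | P 2 ∣? approx (value w) 2 ℤ.- 1ℤ
  ... | yes _ | yes _ = record { ω-cong = ≈[]-refl ; ⟨⟩-cong = ≈[]-lower (ℕ.n≤1+n _) h }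
  ... | no  _ | no  _ = record { ω-cong = ≈[]-refl ; ⟨⟩-cong = congruent (mod-neg (approx-mod (≈[]-lower {x = value u} {value w} (ℕ.n≤1+n _) h))) }
  ... | yes i | no ¬j = ⊥-elim (¬j (mod⇒∣ (mod-+ (approx-mod (≈[]-lower {2} (s≤s (s≤s z≤n)) h)) mod-refl) i))
  ... | no ¬i | yes j = ⊥-elim (¬i (mod⇒∣ (mod-sym (mod-+ (approx-mod (≈[]-lower {2} (s≤s (s≤s z≤n)) h)) mod-refl)) j))

  factor-cong : ∀ {m s t} k u w → s ≈[ suc m ] t → value u ≈[ suc (suc m) ] value w →
                factor s k u ≈[ suc m ] factor t k w
  factor-cong {m} {s} {t} k u w s≈t u≈w = congruent (approx-mod (go (decompose u) (decompose w) (decompose-cong u w u≈w)))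
    where
    go : (d : Decomposition u) (e : Decomposition w) → d ≈ᵈ[ suc m ] e →
         D.⟨x⟩ d ^⟨ -ₚ s ⟩ *ₚ D.ω d ^ˣ k ≈[ suc m ] D.⟨x⟩ e ^⟨ -ₚ t ⟩ *ₚ D.ω e ^ˣ k
    go d e d≈e = congruent (mod-*
      (approx-mod (^⟨⟩-cong {u = D.⟨x⟩ d} {D.⟨x⟩ e} { -ₚ s} { -ₚ t} ⟨⟩-cong (congruent (mod-neg (approx-mod s≈t)))))
      (approx-mod (^ˣ-cong (D.ω d) (D.ω e) k ω-cong (inverse-cong (D.ω d) (D.ω e) ω-cong))))
      where open _≈ᵈ[_]_ d≈e

  ∏-factor-cong : ∀ {m r} (s t : Vector ℤₚ r) (k : Vector ℤ r) (u w : Vector ℤₚˣ r) →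
    (∀ i → s i ≈[ suc m ] t i) → (∀ i → value (u i) ≈[ suc (suc m) ] value (w i)) →
    ∏ₚ (λ i → factor (s i) (k i) (u i)) ≈[ suc m ] ∏ₚ (λ i → factor (t i) (k i) (w i))
  ∏-factor-cong {m} {r} s t k u w s≈t u≈w = ∏ₚ-cong {suc m} {r} (λ i → factor (s i) (k i) (u i)) (λ i → factor (t i) (k i) (w i))
    (λ i → factor-cong {m} {s i} {t i} (k i) (u i) (w i) (s≈t i) (u≈w i))

  -- Membership in the domain depends on `x` modulo p only, so the extension by 0 is a locally
  -- constant cut-off and the two mixed cases are contradictory. The extra digit asked of `x` is the
  -- one lost in `decompose-cong`.
  integrand-cong : ∀ m {r} (s t : Vector ℤₚ r) (k : Vector ℤ r) (γ : Vector ℤₚ r) {x y : Vector ℤₚ r} →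
    (∀ i → s i ≈[ m ] t i) → (∀ i → x i ≈[ suc m ] y i) → integrand s k γ x ≈[ m ] integrand t k γ y
  integrand-cong zero    s t k γ s≈t x≈y = ≈[0]
  integrand-cong (suc m) s t k γ {x} {y} s≈t x≈y = go
    where
    linear-cong : ∀ i → linear s k γ x i ≈[ suc (suc m) ] linear t k γ y i
    linear-cong = partialSum-cong (λ j → x j *ₚ γ j) (λ j → y j *ₚ γ j)
      (λ j → congruent (mod-* (approx-mod (x≈y j)) mod-refl))
    linear-cong₁ : ∀ i → approx (linear s k γ x i) 1 ≡ approx (linear t k γ y i) 1 [mod P 1 ]
    linear-cong₁ i = approx-mod (≈[]-lower {x = linear s k γ x i} {linear t k γ y i} (s≤s z≤n) (linear-cong i))
    go : integrand s k γ x ≈[ suc m ] integrand t k γ y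
    go with domain? s k γ x | domain? t k γ y
    ... | yes d | yes e = congruent (approx-mod
      (∏-factor-cong {m} s t k (λ i → unit (linear s k γ x i) (d i)) (λ i → unit (linear t k γ y i) (e i)) s≈t linear-cong))
    ... | no  _ | no  _ = congruent mod-refl
    ... | yes d | no ¬e = ⊥-elim (¬e (λ i h → d i (mod⇒∣ (mod-sym (linear-cong₁ i)) h)))
    ... | no ¬d | yes e = ⊥-elim (¬d (λ i h → e i (mod⇒∣ (linear-cong₁ i) h)))

-- Integer weights of the doubled measure and the integral as a function of the unit c.

module RegularizedMeasure (p : ℕ) (p-prime : Prime p) where
  open Padic p p-prime
  open PadicCongruences p p-prime
  open RawBoxSums _+ₚ_ _*ₚ_ 0ₚ

  module ModSums (m : ℕ) = BoxSums (isCommutativeRing m)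

  private instance
    p≢0 : NonZero p
    p≢0 = prime⇒nonZero p-prime

  p^≢0 : ∀ N → NonZero (p ℕ.^ N)
  p^≢0 N = ℕ.m^n≢0 p N

  -- The solution of a pᴺ ≡ j (mod c) with 1 ≤ a ≤ c, for j < pᴺ.

  record Index (c N j : ℕ) : Set where
    field
      a t      : ℕ
      equation : a ℕ.* p ℕ.^ N ≡ j ℕ.+ c ℕ.* t
      t>0      : 0 < t
      t≤p^N    : t ℕ.≤ p ℕ.^ N

  c*inverse≡1 : ∀ c (c⊥p : Coprime c p) N → + c ℤ.* approx (inverse (fromℕˣ c c⊥p)) N ≡ 1ℤ [mod P N ]
  c*inverse≡1 c c⊥p N = approx-≡ (inverseʳ (fromℕˣ c c⊥p)) N

  solveIndex : ∀ c → Coprime c p → ∀ N j → Index c N j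
  solveIndex c c⊥p N j = record
    { a = ℕ._∣_.quotient p^N∣ ; t = suc t₀ ; equation = ≡.sym (ℕ._∣_.equality p^N∣)
    ; t>0 = s≤s z≤n ; t≤p^N = ℤ.n%ℕd<d z (p ℕ.^ N) }
    where
    instance _ = p^≢0 N
    u z : ℤ
    u = approx (inverse (fromℕˣ c c⊥p)) N
    -- Modulo p^N this is -j/c - 1. Subtracting 1 before the reduction and adding it afterwards puts
    -- `t` among 1, ..., p^N rather than 0, ..., p^N - 1, and this range is what yields 1 ≤ a ≤ c.
    z = ℤ.- (+ j ℤ.* u) ℤ.- 1ℤ
    t₀ = z ℤ.%ℕ (p ℕ.^ N)
    eq₁ : ∀ x y → (x ℤ.+ y) ℤ.- x ≡ y
    eq₁ = ℤ.solve-∀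
    z≡t₀ : z ≡ + t₀ [mod P N ]
    z≡t₀ = mod (divides (z ℤ./ℕ (p ℕ.^ N))
      (≡.trans (≡.cong (ℤ._- + t₀) (ℤ.a≡a%ℕn+[a/ℕn]*n z (p ℕ.^ N))) (eq₁ (+ t₀) _)))
    eq₂ : ∀ j c u → j ℤ.+ c ℤ.* (1ℤ ℤ.+ (ℤ.- (j ℤ.* u) ℤ.- 1ℤ)) ≡ j ℤ.+ ℤ.- (j ℤ.* (c ℤ.* u))
    eq₂ = ℤ.solve-∀
    eq₃ : ∀ j → j ℤ.+ ℤ.- (j ℤ.* 1ℤ) ≡ 0ℤ
    eq₃ = ℤ.solve-∀
    j+ct≡0 : + j ℤ.+ + c ℤ.* (1ℤ ℤ.+ + t₀) ≡ 0ℤ [mod P N ]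
    j+ct≡0 = mod-trans (mod-+ (mod-refl {a = + j}) (mod-* (mod-refl {a = + c}) (mod-+ (mod-refl {a = 1ℤ}) (mod-sym z≡t₀))))
      (mod-trans (mod-reflexive (eq₂ (+ j) (+ c) u))
      (mod-trans (mod-+ (mod-refl {a = + j}) (mod-neg (mod-* (mod-refl {a = + j}) (c*inverse≡1 c c⊥p N)))) (mod-reflexive (eq₃ (+ j)))))
    pos : + j ℤ.+ + c ℤ.* (1ℤ ℤ.+ + t₀) ≡ + (j ℕ.+ c ℕ.* suc t₀)
    pos = ≡.sym (≡.trans (ℤ.pos-+ j (c ℕ.* suc t₀)) (≡.cong (λ x → + j ℤ.+ x) (ℤ.pos-* c (suc t₀))))
    p^N∣ : p ℕ.^ N ℕ.∣ j ℕ.+ c ℕ.* suc t₀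
    p^N∣ = ∣⇒∣ᵤ (≡.subst (P N ∣_) pos (mod⇒∣ (mod-sym j+ct≡0) (divides 0ℤ ≡.refl)))

  opaque
    index : ∀ c → Coprime c p → ∀ N j → Index c N j
    index = solveIndex

  index-≥1 : ∀ {c N j} → 0 < c → (i : Index c N j) → 1 ℕ.≤ Index.a i
  index-≥1 {c} {N} {j} 0<c i with Index.a i | Index.equation i
  ... | suc _ | _ = s≤s z≤n
  ... | zero  | e = ⊥-elim (ℕ.<⇒≢ (ℕ.≤-trans (ℕ.*-mono-≤ 0<c (Index.t>0 i)) (ℕ.m≤n+m _ j)) e)

  index-≤c : ∀ {c N j} → j < p ℕ.^ N → (i : Index c N j) → Index.a i ℕ.≤ c
  index-≤c {c} {N} {j} j<p^N i = ℕ.≤-pred (ℕ.*-cancelʳ-< (p ℕ.^ N) a (suc c) (begin-strict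
    a ℕ.* p ℕ.^ N         ≡⟨ equation ⟩
    j ℕ.+ c ℕ.* t         ≤⟨ ℕ.+-monoʳ-≤ j (ℕ.*-monoʳ-≤ c t≤p^N) ⟩
    j ℕ.+ c ℕ.* p ℕ.^ N   <⟨ ℕ.+-monoˡ-< (c ℕ.* p ℕ.^ N) j<p^N ⟩
    suc c ℕ.* p ℕ.^ N     ∎))
    where
    open Index i
    open ℕ.≤-Reasoning

  mod⇒≡ : ∀ {N t u} → 0 < t → t ℕ.≤ p ℕ.^ N → 0 < u → u ℕ.≤ p ℕ.^ N → + t ≡ + u [mod P N ] → t ≡ u
  mod⇒≡ {N} {t} {u} 0<t t≤ 0<u u≤ t≡u =
    [ (λ t≤u → go 0<t u≤ t≤u (mod-sym t≡u)) , (λ u≤t → ≡.sym (go 0<u t≤ u≤t t≡u)) ]′ (ℕ.≤-total t u)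
    where
    go : ∀ {x y} → 0 < x → y ℕ.≤ p ℕ.^ N → x ℕ.≤ y → + y ≡ + x [mod P N ] → x ≡ y
    go {x} {y} 0<x y≤ x≤y (mod d) with y ℕ.∸ x in eq
    ... | zero    = ℕ.≤-antisym x≤y (ℕ.m∸n≡0⇒m≤n eq)
    ... | k@(suc _) = ⊥-elim (ℕ.>⇒∤ (ℕ.<-≤-trans (≡.subst (_< y) eq (ℕ.∸-monoʳ-< {y} {x} {0} 0<x x≤y)) y≤) (≡.subst (p ℕ.^ N ℕ.∣_) eq
        (∣⇒∣ᵤ (≡.subst (P N ∣_) (≡.trans (ℤ.m-n≡m⊖n y x) (ℤ.⊖-≥ x≤y)) d))))

  index-equation : ∀ {c N j} (i : Index c N j) → + Index.a i ℤ.* P N ≡ + j ℤ.+ + c ℤ.* + Index.t i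
  index-equation {c} {N} {j} i = ≡.trans (≡.sym (ℤ.pos-* a (p ℕ.^ N)))
    (≡.trans (≡.cong +_ equation) (≡.trans (ℤ.pos-+ j (c ℕ.* t)) (≡.cong (λ x → + j ℤ.+ x) (ℤ.pos-* c t))))
    where open Index i

  -- By the equation, `t` is -j/c modulo p^N, and its range then makes it a function of c modulo
  -- p^N; so `c` and `d` share the same `t`. Subtracting the two equations leaves (a - a′) p^N = (c
  -- - d) t, and cancelling p^N uses up N of the N + m digits.
  index-cong : ∀ {c d N j m} → Coprime c p → (i : Index c N j) (k : Index d N j) →
               + c ≡ + d [mod P (N ℕ.+ m) ] → + Index.a i ≡ + Index.a k [mod P m ]
  index-cong {c} {d} {N} {j} {m} c⊥p i k c≡d@(mod (divides q c-d≡)) =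
    mod (divides (q ℤ.* + t) (ℤ.*-cancelʳ-≡ _ _ (P N) {{p^≢0 N}} (begin
      (+ a ℤ.- + a′) ℤ.* P N                                ≡⟨ eq₁ (+ a) (+ a′) (P N) ⟩
      + a ℤ.* P N ℤ.- + a′ ℤ.* P N                          ≡⟨ ≡.cong₂ ℤ._-_ (index-equation i) (index-equation k) ⟩
      (+ j ℤ.+ + c ℤ.* + t) ℤ.- (+ j ℤ.+ + d ℤ.* + t′)      ≡⟨ ≡.cong (λ x → (+ j ℤ.+ + c ℤ.* + t) ℤ.- (+ j ℤ.+ + d ℤ.* + x)) t≡t′ ⟨
      (+ j ℤ.+ + c ℤ.* + t) ℤ.- (+ j ℤ.+ + d ℤ.* + t)       ≡⟨ eq₂ (+ j) (+ c) (+ d) (+ t) ⟩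
      (+ c ℤ.- + d) ℤ.* + t                                 ≡⟨ ≡.cong (ℤ._* + t) c-d≡ ⟩
      (q ℤ.* P (N ℕ.+ m)) ℤ.* + t                           ≡⟨ ≡.cong (λ x → (q ℤ.* x) ℤ.* + t) P-+ ⟩
      (q ℤ.* (P N ℤ.* P m)) ℤ.* + t                         ≡⟨ eq₃ q (P N) (P m) (+ t) ⟩
      (q ℤ.* + t ℤ.* P m) ℤ.* P N                           ∎)))
    where
    open ≡.≡-Reasoning
    open Index i using (a; t)
    open Index k using () renaming (a to a′; t to t′)
    eq₁ : ∀ a b x → (a ℤ.- b) ℤ.* x ≡ a ℤ.* x ℤ.- b ℤ.* x
    eq₁ = ℤ.solve-∀
    eq₂ : ∀ j c d t → (j ℤ.+ c ℤ.* t) ℤ.- (j ℤ.+ d ℤ.* t) ≡ (c ℤ.- d) ℤ.* t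
    eq₂ = ℤ.solve-∀
    eq₃ : ∀ q x y t → (q ℤ.* (x ℤ.* y)) ℤ.* t ≡ (q ℤ.* t ℤ.* y) ℤ.* x
    eq₃ = ℤ.solve-∀
    P-+ : P (N ℕ.+ m) ≡ P N ℤ.* P m
    P-+ = ≡.trans (≡.cong +_ (ℕ.^-distribˡ-+-* p N m)) (ℤ.pos-* (p ℕ.^ N) (p ℕ.^ m))
    ct≡-j : ∀ {c} (i : Index c N j) → + c ℤ.* + Index.t i ≡ ℤ.- + j [mod P N ]
    ct≡-j {c} i = mod (divides (+ Index.a i) (≡.trans (eq₄ (+ c ℤ.* + Index.t i) (+ j)) (≡.sym (index-equation i))))
      where
      eq₄ : ∀ x j → x ℤ.- ℤ.- j ≡ j ℤ.+ x
      eq₄ = ℤ.solve-∀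
    u = approx (inverse (fromℕˣ c c⊥p)) N
    eq₅ : ∀ u c t → (c ℤ.* u) ℤ.* t ≡ u ℤ.* (c ℤ.* t)
    eq₅ = ℤ.solve-∀
    cancel : ∀ x → u ℤ.* (+ c ℤ.* x) ≡ x [mod P N ]
    cancel x = mod-trans (mod-reflexive (≡.sym (eq₅ u (+ c) x)))
      (mod-trans (mod-* (c*inverse≡1 c c⊥p N) mod-refl) (mod-reflexive (ℤ.*-identityˡ x)))
    ct≡ct′ : + c ℤ.* + t ≡ + c ℤ.* + t′ [mod P N ]
    ct≡ct′ = mod-trans (ct≡-j i) (mod-trans (mod-sym (ct≡-j k))
      (mod-* (mod-sym (mod-weaken (P-mono (ℕ.m≤m+n N m)) c≡d)) mod-refl))
    t≡t′ : t ≡ t′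
    t≡t′ = mod⇒≡ {N} (Index.t>0 i) (Index.t≤p^N i) (Index.t>0 k) (Index.t≤p^N k)
      (mod-trans (mod-sym (cancel (+ t))) (mod-trans (mod-* (mod-refl {a = u}) ct≡ct′) (cancel (+ t′))))

  -- Twice the mass of j + pᴺℤₚ, an integer also for p = 2.

  weight : ∀ c → Coprime c p → ℕ → ℕ → ℤ
  weight c c⊥p N j = (+ a ℤ.+ + a) ℤ.- + suc c
    where open Index (index c c⊥p N j)

  weight-cong : ∀ {c d N m} (c⊥p : Coprime c p) (d⊥p : Coprime d p) → + c ≡ + d [mod P (N ℕ.+ m) ] →
                ∀ j → weight c c⊥p N j ≡ weight d d⊥p N j [mod P m ]
  weight-cong {c} {d} {N} {m} c⊥p d⊥p c≡d j = mod-+ (mod-+ a≡a′ a≡a′) (mod-neg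
    (mod-+ (mod-refl {a = 1ℤ}) (mod-weaken (P-mono (ℕ.m≤n+m m N)) c≡d)))
    where a≡a′ = index-cong {m = m} c⊥p (index c c⊥p N j) (index d d⊥p N j) c≡d

  weightₚ : ∀ c → Coprime c p → ℕ → ℕ → ℤₚ
  weightₚ c c⊥p N j = fromℤ (weight c c⊥p N j)

  sample : ∀ {r} → (Vector ℤₚ r → ℤₚ) → Vector ℕ r → ℤₚ
  sample f js = f (λ i → fromℤ (+ js i))

  -- A hypothesis in this part; it is supplied later from the sums over roots of unity.
  Additive : ∀ c → Coprime c p → Set
  Additive c c⊥p = ∀ m N j → j < p ℕ.^ N → weightₚ c c⊥p N j ≈[ m ]
    rangeSum p (λ i → weightₚ c c⊥p (suc N) (j ℕ.+ i ℕ.* p ℕ.^ N))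

  -- This is 2^r times the Riemann sum of `f`, one factor 2 for each coordinate.
  doubledSum : ∀ {r} → (Vector ℤₚ r → ℤₚ) → ∀ c → Coprime c p → ℕ → ℤₚ
  doubledSum {r} f c c⊥p N = weightedSum r (p ℕ.^ N) (weightₚ c c⊥p N) (sample f)

  module _ {r : ℕ} where

    infix 4 _≈ᶠ[_]_

    _≈ᶠ[_]_ : (f : Vector ℤₚ r → ℤₚ) → ℕ → (g : Vector ℤₚ r → ℤₚ) → Set
    f ≈ᶠ[ m ] g = ∀ x → f x ≈[ m ] g x

    Lipschitz : (Vector ℤₚ r → ℤₚ) → Set
    Lipschitz f = ∀ m {x y : Vector ℤₚ r} → (∀ i → x i ≈[ suc m ] y i) → f x ≈[ m ] f y

    doubledSum-cong : ∀ (f g : Vector ℤₚ r → ℤₚ) {c d} (c⊥p : Coprime c p) (d⊥p : Coprime d p) N m →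
      f ≈ᶠ[ m ] g → + c ≡ + d [mod P (N ℕ.+ m) ] → doubledSum f c c⊥p N ≈[ m ] doubledSum g d d⊥p N
    doubledSum-cong f g {c} {d} c⊥p d⊥p N m f≈g c≡d =
      ModSums.weightedSum-cong m r (p ℕ.^ N) {weightₚ c c⊥p N} {weightₚ d d⊥p N} {sample f} {sample g}
        (λ j _ → congruent (weight-cong {c} {d} {N} {m} c⊥p d⊥p c≡d j)) (λ js → f≈g (λ i → fromℤ (+ js i)))

    module _ (f : Vector ℤₚ r → ℤₚ) (f-lip : Lipschitz f) {c : ℕ} (c⊥p : Coprime c p) (additive : Additive c c⊥p) where

      -- For m < N the points j and j + i p^N agree modulo p^(m+1), so `f` agrees on them modulo p^m
      -- and only the weights are affected by the refinement.
      doubledSum-refine : ∀ N m → m < N → doubledSum f c c⊥p (suc N) ≈[ m ] doubledSum f c c⊥p N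
      doubledSum-refine N m m<N =
        ModSums.weightedSum-refine m {p} {p ℕ.^ N} {weightₚ c c⊥p N} {weightₚ c c⊥p (suc N)}
          (additive m N) (λ j j′ → + j ≡ + j′ [mod P (suc m) ]) (λ _ → mod-refl) shift r (sample f)
          (λ js js′ h → f-lip m {λ i → fromℤ (+ js i)} {λ i → fromℤ (+ js′ i)} (λ i → congruent (h i)))
        where
        eq : ∀ x y → (x ℤ.+ y) ℤ.- x ≡ y
        eq = ℤ.solve-∀
        shift : ∀ j i → + (j ℕ.+ i ℕ.* p ℕ.^ N) ≡ + j [mod P (suc m) ]
        shift j i = mod-weaken (P-mono m<N) (mod (divides (+ i)
          (≡.trans (≡.cong (ℤ._- + j) (≡.trans (ℤ.pos-+ j _) (≡.cong (λ x → + j ℤ.+ x) (ℤ.pos-* i (p ℕ.^ N)))))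
                   (eq (+ j) (+ i ℤ.* P N)))))

      doubledSum-stable : ∀ N m → m < N → doubledSum f c c⊥p N ≈[ m ] doubledSum f c c⊥p (suc m)
      doubledSum-stable N m m<N =
        ≡.subst (λ n → doubledSum f c c⊥p n ≈[ m ] doubledSum f c c⊥p (suc m)) (ℕ.m∸n+n≡m m<N) (go (N ℕ.∸ suc m))
        where
        go : ∀ k → doubledSum f c c⊥p (k ℕ.+ suc m) ≈[ m ] doubledSum f c c⊥p (suc m)
        go zero    = ≈[]-refl
        go (suc k) = ≈[]-trans {m} {doubledSum f c c⊥p (suc k ℕ.+ suc m)} {doubledSum f c c⊥p (k ℕ.+ suc m)}
          {doubledSum f c c⊥p (suc m)} (doubledSum-refine (k ℕ.+ suc m) m (ℕ.m≤n+m (suc m) k)) (go k)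

  -- Adding p^n keeps the residue and, for n > 0, lifts the representative above 1, where the
  -- measure is defined.
  representative : ℤₚˣ → ℕ → ℕ
  representative c n = exponent (value c) n ℕ.+ p ℕ.^ n

  representative-≡ : ∀ c n → approx (value c) n ≡ + representative c n [mod P n ]
  representative-≡ c n = mod-trans (exponent-≡ (value c) n) (mod (divides -1ℤ
    (≡.trans (≡.cong (ℤ._-_ (+ e)) (ℤ.pos-+ e (p ℕ.^ n))) (eq (+ e) (P n)))))
    where
    e = exponent (value c) n
    eq : ∀ x y → x ℤ.- (x ℤ.+ y) ≡ -1ℤ ℤ.* y
    eq = ℤ.solve-∀

  1<representative : ∀ c n → 1 < representative c (suc n)
  1<representative c n = ℕ.≤-trans (ℕ.≤-trans (ℕ.nonTrivial⇒n>1 p {{prime⇒nonTrivial p-prime}})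
    (ℕ.m≤m*n p (p ℕ.^ n) {{p^≢0 n}})) (ℕ.m≤n+m _ (exponent (value c) (suc n)))

  representative-coprime : ∀ c n → Coprime (representative c (suc n)) p
  representative-coprime c n {d} (d∣c , d∣p) with prime⇒irreducible p-prime d∣p
  ... | inj₁ d≡1    = d≡1
  ... | inj₂ ≡.refl = ⊥-elim (p∤unit c n (mod⇒∣
    (mod-weaken (≡.subst (_∣ P (suc n)) P1≡p (P-mono {1} {suc n} (s≤s z≤n))) (mod-sym (representative-≡ c (suc n))))
    (∣ᵤ⇒∣ d∣c)))

  -- The precision N + m that `weight-cong` asks of c, at the cell level N = m + 1.
  level : ℕ → ℕ
  level m = suc m ℕ.+ m

  module Integral (additive : ∀ c → 1 < c → (c⊥p : Coprime c p) → Additive c c⊥p)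
                  {r : ℕ} (f : Vector ℤₚ r → ℤₚ) (f-lip : Lipschitz f) where

    -- The representative of c modulo p²ᵐ⁺¹ determines the doubled Riemann sum over the cells
    -- of radius p⁻ᵐ⁻¹ modulo pᵐ, and that sum determines the integral modulo pᵐ.

    step : ℤₚˣ → ℕ → ℤₚ
    step c m = doubledSum f (representative c (level m)) (representative-coprime c (m ℕ.+ m)) (suc m)

    -- Two changes made in turn: with the finer representative kept, the cells are coarsened by one
    -- level; then, on the coarser cells, the representative is exchanged.
    step-suc : ∀ c m → step c (suc m) ≈[ m ] step c m
    step-suc c m = ≈[]-trans {m} {step c (suc m)} {doubledSum f d d⊥p (suc m)} {step c m}
      (doubledSum-refine f f-lip d⊥p (additive d (1<representative c (suc m ℕ.+ suc m)) d⊥p) (suc m) m ℕ.≤-refl)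
      (doubledSum-cong f f d⊥p (representative-coprime c (m ℕ.+ m)) (suc m) m (λ _ → ≈[]-refl) d≡)
      where
      d = representative c (level (suc m))
      d⊥p = representative-coprime c (suc m ℕ.+ suc m)
      level≤ : level m ℕ.≤ level (suc m)
      level≤ = ℕ.+-mono-≤ (ℕ.n≤1+n (suc m)) (ℕ.n≤1+n m)
      d≡ : + d ≡ + representative c (level m) [mod P (level m) ]
      d≡ = mod-trans (mod-sym (mod-weaken (P-mono level≤) (representative-≡ c (level (suc m)))))
        (mod-trans (approx-≤ (value c) level≤) (representative-≡ c (level m)))

    opaque
      -- A diagonal: the m-th step is consulted only for its residue modulo p^m.
      doubledIntegral : ℤₚˣ → ℤₚ
      doubledIntegral c = record
        { approx   = λ m → approx (step c m) m
        ; coherent = λ m → mod-trans (coherent (step c (suc m)) m) (approx-mod (step-suc c m)) }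

      doubledIntegral-step : ∀ c m → doubledIntegral c ≈[ m ] step c m
      doubledIntegral-step c m = congruent mod-refl

    doubledSum-step : ∀ c (c⊥p : Coprime c p) m → doubledSum f c c⊥p (suc m) ≈[ m ] step (fromℕˣ c c⊥p) m
    doubledSum-step c c⊥p m = doubledSum-cong f f c⊥p (representative-coprime (fromℕˣ c c⊥p) (m ℕ.+ m)) (suc m) m
      (λ _ → ≈[]-refl) (representative-≡ (fromℕˣ c c⊥p) (level m))

    doubledIntegral-limit : ∀ c → 1 < c → (c⊥p : Coprime c p) → ∀ N m → m < N →
                            doubledSum f c c⊥p N ≈[ m ] doubledIntegral (fromℕˣ c c⊥p)
    doubledIntegral-limit c 1<c c⊥p N m m<N =
      ≈[]-trans {m} {doubledSum f c c⊥p N} {doubledSum f c c⊥p (suc m)} {doubledIntegral (fromℕˣ c c⊥p)}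
        (doubledSum-stable f f-lip c⊥p (additive c 1<c c⊥p) N m m<N)
      (≈[]-trans {m} {doubledSum f c c⊥p (suc m)} {step (fromℕˣ c c⊥p) m} {doubledIntegral (fromℕˣ c c⊥p)}
        (doubledSum-step c c⊥p m)
        (≈[]-sym {m} {doubledIntegral (fromℕˣ c c⊥p)} {step (fromℕˣ c c⊥p) m} (doubledIntegral-step (fromℕˣ c c⊥p) m)))

  module _ (additive : ∀ c → 1 < c → (c⊥p : Coprime c p) → Additive c c⊥p) {r : ℕ}
           (f g : Vector ℤₚ r → ℤₚ) (f-lip : Lipschitz f) (g-lip : Lipschitz g) where
    private
      module F = Integral additive f f-lip
      module G = Integral additive g g-lip

    step-cong : ∀ c d m → f ≈ᶠ[ m ] g → value c ≈[ level m ] value d → F.step c m ≈[ m ] G.step d m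
    step-cong c d m f≈g c≈d =
      doubledSum-cong f g (representative-coprime c (m ℕ.+ m)) (representative-coprime d (m ℕ.+ m)) (suc m) m f≈g
        (mod-trans (mod-sym (representative-≡ c (level m))) (mod-trans (approx-mod c≈d) (representative-≡ d (level m))))

    doubledIntegral-cong : ∀ c d m → f ≈ᶠ[ m ] g → value c ≈[ level m ] value d →
                           F.doubledIntegral c ≈[ m ] G.doubledIntegral d
    doubledIntegral-cong c d m f≈g c≈d =
      ≈[]-trans {m} {F.doubledIntegral c} {F.step c m} {G.doubledIntegral d} (F.doubledIntegral-step c m)
      (≈[]-trans {m} {F.step c m} {G.step d m} {G.doubledIntegral d} (step-cong c d m f≈g c≈d)
        (≈[]-sym {m} {G.doubledIntegral d} {G.step d m} (G.doubledIntegral-step d m)))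

-- Nontrivial roots of unity and their power sums.

module RootsOfUnity {c ℓ₁ ℓ₂} (F : HeytingField c ℓ₁ ℓ₂) where
  open HeytingField F hiding (zero; _-_)
  open HeytingCommutativeRing heytingCommutativeRing using (commutativeRing)
  open CommutativeRing commutativeRing using (rawRing; semiring; _-_)
  open HeytingProperties heytingCommutativeRing using (#-congʳ)
  open RawSemiringDefs (RawRing.rawSemiring rawRing) using (_^_)
  open SemiringMult semiring using (×-comm-*; ×-congʳ) renaming (_×_ to _·_)
  open SemiringSum semiring using (sum; sum-cong-≋)
  open RingSolver commutativeRing
  open MonicPolynomials F
  open SetoidReasoning setoid

  -- The polynomials Xᵈ and Xᵈ⁺¹ - 1.

  power : ∀ d → Vector Carrier d
  power d _ = 0#

  unity : ∀ d → Vector Carrier (suc d)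
  unity d = (- 1#) ∷ power d

  eval-power : ∀ d x → eval (power d) x ≈ x ^ d
  eval-power zero    x = refl
  eval-power (suc d) x = trans (+-identityˡ _) (*-congˡ (eval-power d x))

  eval-unity : ∀ d x → eval (unity d) x ≈ x ^ suc d - 1#
  eval-unity d x = trans (+-comm _ _) (+-congʳ (*-congˡ (eval-power d x)))

  -- The factor `x` avoids the exponent d - 1.
  derivative-power : ∀ d x → x * derivative (power d) x ≈ d · x ^ d
  derivative-power zero    x = zeroʳ x
  derivative-power (suc d) x = begin
    x * (eval (power d) x + x * derivative (power d) x)  ≈⟨ *-congˡ (+-cong (eval-power d x) (derivative-power d x)) ⟩
    x * (suc d · x ^ d)                                  ≈⟨ ×-comm-* (suc d) x (x ^ d) ⟩
    suc d · x ^ suc d                                    ∎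

  evalDrop-power : ∀ k n x → evalDrop k (power (k ℕ.+ n)) x ≈ x ^ n
  evalDrop-power zero    n x = eval-power n x
  evalDrop-power (suc k) n x = evalDrop-power k n x

  coefficient-power : ∀ k n → coefficient k (power (k ℕ.+ suc n)) ≈ 0#
  coefficient-power zero    n = refl
  coefficient-power (suc k) n = coefficient-power k n

  unity-root : ∀ d {x} → eval (unity d) x ≈ 0# → x ^ suc d ≈ 1#
  unity-root d h = -≈0⇒≈ (trans (sym (eval-unity d _)) h)

  root-unity : ∀ d {x} → x ^ suc d ≈ 1# → eval (unity d) x ≈ 0#
  root-unity d h = trans (eval-unity d _) (trans (+-congʳ h) (-‿inverseʳ 1#))

  module _ (closed : ∀ n (a : Vector Carrier (suc n)) → ∃ λ x → eval a x ≈ 0#)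
           (d : ℕ) (char∤d+1 : suc d · 1# # 0#) where

    -- At a root y, y times the derivative is (d + 1) y^(d+1) = d + 1, which is apart from 0.
    unity-separable : Separable (unity d)
    unity-separable y h = *-#0ʳ (#-congʳ (begin
      suc d · 1#                     ≈⟨ ×-congʳ (suc d) (unity-root d h) ⟨
      suc d · y ^ suc d              ≈⟨ ×-comm-* (suc d) y (y ^ d) ⟨
      y * (suc d · y ^ d)            ≈⟨ *-congˡ (+-cong (eval-power d y) (derivative-power d y)) ⟨
      y * derivative (unity d) y     ∎) char∤d+1)

    private
      1-root : eval (unity d) 1# ≈ 0#
      1-root = root-unity d (1#^ (suc d))

      opaque
        nontrivial : Splitting (quotient (unity d) 1#)
        nontrivial = split closed d (quotient (unity d) 1#) (quotient-separable (unity d) unity-separable 1-root)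

    open Splitting nontrivial public using (distinct) renaming (root to ζ)

    ζ-root : ∀ i → ζ i ^ suc d ≈ 1#
    ζ-root i = unity-root d {ζ i} (quotient-root (unity d) unity-separable {1#} 1-root {ζ i} (Splitting.isRoot nontrivial i))

    ζ-nontrivial : ∀ i → ζ i # 1#
    ζ-nontrivial i = quotient-root-# (unity d) unity-separable {1#} 1-root {ζ i} (Splitting.isRoot nontrivial i)

    ζ-covers : ∀ ξ → ξ ^ suc d ≈ 1# → ξ # 1# → ∃ λ i → ξ ≈ ζ i
    ζ-covers ξ ξ^≈1 ξ#1 = [ (λ ξ≈1 → ⊥-elim (#-irrefl ξ≈1 ξ#1)) , Splitting.covers nontrivial ξ ]′
      (root-cases (unity d) unity-separable {1#} 1-root {ξ} (root-unity d ξ^≈1))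

    -- Dropping the k + 1 lowest coefficients of X^(d+1) - 1 leaves X^(n+1), and the coefficient of
    -- X^(k+1) is 0 because 0 < k + 1 < d + 1. Newton's identity thus makes the power sum over all
    -- roots vanish, and the root 1 accounts for the -1.
    ζ-powerSum′ : ∀ k n → k ℕ.+ suc n ≡ d → sum (λ i → ζ i ^ suc n) ≈ - 1#
    ζ-powerSum′ k n ≡.refl = begin
      S                     ≈⟨ solve 1 (λ S → S := (:1 :+ S) :- :1) refl S ⟩
      (1# + S) - 1#         ≈⟨ +-congʳ (+-cong (trans (sym (1#^ (suc n))) (sym (evalDrop-power k (suc n) 1#)))
                                 (sum-cong-≋ {d} (λ i → sym (evalDrop-power k (suc n) (ζ i))))) ⟩
      sum {suc d} (λ i → evalDrop (suc k) (unity d) ((1# ∷ ζ) i)) - 1#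
                            ≈⟨ +-congʳ (Splitting.powerSums (consSplitting (unity d) unity-separable {1#} 1-root nontrivial) (suc k)) ⟩
      suc k · coefficient (suc k) (unity d) - 1#
                            ≈⟨ +-congʳ (trans (×-congʳ (suc k) (coefficient-power k n)) (·-zeroʳ (suc k))) ⟩
      0# - 1#               ≈⟨ +-identityˡ _ ⟩
      - 1#                  ∎
      where
      S = sum (λ i → ζ i ^ suc n)

    ζ-powerSum : ∀ n → 0 < n → n ℕ.≤ d → sum (λ i → ζ i ^ n) ≈ - 1#
    ζ-powerSum (suc n) _ n<d = ζ-powerSum′ (d ℕ.∸ suc n) n (ℕ.m∸n+n≡m n<d)

-- Evaluation of the masses attached to the roots of unity.

-- The masses Σᵢ ξᵢʲ / (1 - ξᵢᴹ) for the nontrivial c-th roots of unity ξᵢ and M prime to c.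

module RootMasses {a ℓ₁ ℓ₂} (F : HeytingField a ℓ₁ ℓ₂) where
  open HeytingField F hiding (zero; _-_)
  open HeytingCommutativeRing heytingCommutativeRing using (commutativeRing)
  open CommutativeRing commutativeRing using (rawRing; semiring; _-_)
  open RawSemiringDefs (RawRing.rawSemiring rawRing) using (_^_)
  open SemiringMult semiring using (×-homo-+) renaming (_×_ to _·_)
  open SemiringExp semiring using (^-homo-*; ^-assocʳ; ^-congˡ)
  open SemiringSum semiring using (sum; sum-cong-≋; ∑-comm; *-distribˡ-sum; *-distribʳ-sum; ∑-distrib-+; sum-replicate-zero)
  open RingSolver commutativeRing
  open MonicPolynomials F using (1#^; *-cancel-#0)
  open BoxSums isCommutativeRing
  open SetoidReasoning setoid

  geometricSum : ∀ n x → rangeSum n (λ b → x ^ b) * (1# - x) ≈ 1# - x ^ n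
  geometricSum zero    x = solve 1 (λ x → :0 :* (:1 :- x) := :1 :- :1) refl x
  geometricSum (suc n) x = begin
    (1# + rangeSum n (λ b → x * x ^ b)) * (1# - x)
      ≈⟨ *-congʳ (+-congˡ (*-distribˡ-sum {n} x (λ b → x ^ toℕ b))) ⟨
    (1# + x * rangeSum n (λ b → x ^ b)) * (1# - x)
      ≈⟨ solve 2 (λ x S → (:1 :+ x :* S) :* (:1 :- x) := (:1 :- x) :+ x :* (S :* (:1 :- x))) refl x _ ⟩
    (1# - x) + x * (rangeSum n (λ b → x ^ b) * (1# - x))
      ≈⟨ +-congˡ (*-congˡ (geometricSum n x)) ⟩
    (1# - x) + x * (1# - x ^ n)
      ≈⟨ solve 2 (λ x y → (:1 :- x) :+ x :* (:1 :- y) := :1 :- x :* y) refl x (x ^ n) ⟩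
    1# - x ^ suc n ∎

  arithmeticSum : ∀ n x → rangeSum n (λ b → x + b · 1#) + rangeSum n (λ b → x + b · 1#) ≈ n · 1# * (x + x + (n · 1# - 1#))
  arithmeticSum zero    x = solve 1 (λ x → :0 :+ :0 := :0 :* (x :+ x :+ (:0 :- :1))) refl x
  arithmeticSum (suc n) x = begin
    ((x + 0#) + T) + ((x + 0#) + T)
      ≈⟨ solve 2 (λ x T → ((x :+ :0) :+ T) :+ ((x :+ :0) :+ T) := (x :+ x) :+ (T :+ T)) refl x T ⟩
    (x + x) + (T + T)
      ≈⟨ +-congˡ (+-cong T≈ T≈) ⟩
    (x + x) + (rangeSum n (λ b → (x + 1#) + b · 1#) + rangeSum n (λ b → (x + 1#) + b · 1#))
      ≈⟨ +-congˡ (arithmeticSum n (x + 1#)) ⟩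
    (x + x) + n · 1# * ((x + 1#) + (x + 1#) + (n · 1# - 1#))
      ≈⟨ solve 2 (λ x n → (x :+ x) :+ n :* ((x :+ :1) :+ (x :+ :1) :+ (n :- :1)) := (:1 :+ n) :* (x :+ x :+ ((:1 :+ n) :- :1))) refl x (n · 1#) ⟩
    suc n · 1# * (x + x + (suc n · 1# - 1#)) ∎
    where
    T = rangeSum n (λ b → x + suc b · 1#)
    T≈ : T ≈ rangeSum n (λ b → (x + 1#) + b · 1#)
    T≈ = rangeSum-cong n (λ b _ → sym (+-assoc x 1# (b · 1#)))

  ^-+ : ∀ x m n → x ^ (m ℕ.+ n) ≈ x ^ m * x ^ n
  ^-+ = ^-homo-*

  ^-* : ∀ x m n → x ^ (m ℕ.* n) ≈ (x ^ m) ^ n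
  ^-* x m n = sym (^-assocʳ x m n)

  ^-*ʳ : ∀ x m n → x ^ (m ℕ.* n) ≈ (x ^ n) ^ m
  ^-*ʳ x m n = trans (reflexive (≡.cong (x ^_) (ℕ.*-comm m n))) (^-* x n m)

  ^-periodic : ∀ {x c} → x ^ c ≈ 1# → ∀ j t → x ^ (j ℕ.+ c ℕ.* t) ≈ x ^ j
  ^-periodic {x} {c} x^c≈1 j t = begin
    x ^ (j ℕ.+ c ℕ.* t)       ≈⟨ ^-+ x j (c ℕ.* t) ⟩
    x ^ j * x ^ (c ℕ.* t)     ≈⟨ *-congˡ (^-* x c t) ⟩
    x ^ j * (x ^ c) ^ t       ≈⟨ *-congˡ (trans (^-congˡ t x^c≈1) (1#^ t)) ⟩
    x ^ j * 1#                ≈⟨ *-identityʳ _ ⟩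
    x ^ j                     ∎

  mass : ∀ {n} → Vector Carrier n → Vector Carrier n → ℕ → Carrier
  mass ξ y j = sum (λ i → ξ i ^ j * y i)

  -- Root by root this is 1 / (1 - x) = (1 + x + ... + x^(p-1)) / (1 - x^p) with x = ξ^M.
  mass-additive : ∀ p M {n} (ξ y z : Vector Carrier n) →
    (∀ i → y i * (1# - ξ i ^ M) ≈ 1#) → (∀ i → z i * (1# - ξ i ^ (p ℕ.* M)) ≈ 1#) →
    ∀ j → mass ξ y j ≈ rangeSum p (λ k → mass ξ z (j ℕ.+ k ℕ.* M))
  mass-additive p M {n} ξ y z y-inv z-inv j = begin
    sum (λ i → ξ i ^ j * y i)
      ≈⟨ sum-cong-≋ {n} refineRoot ⟩
    sum (λ i → rangeSum p (λ k → ξ i ^ (j ℕ.+ k ℕ.* M) * z i))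
      ≈⟨ ∑-comm {n} {p} (λ i k → ξ i ^ (j ℕ.+ toℕ k ℕ.* M) * z i) ⟩
    rangeSum p (λ k → mass ξ z (j ℕ.+ k ℕ.* M)) ∎
    where
    refineRoot : ∀ i → ξ i ^ j * y i ≈ rangeSum p (λ k → ξ i ^ (j ℕ.+ k ℕ.* M) * z i)
    refineRoot i = begin
      w * y i
        ≈⟨ *-identityʳ _ ⟨
      w * y i * 1#
        ≈⟨ *-congˡ (trans (*-congˡ (+-congˡ (-‿cong (sym (^-*ʳ (ξ i) p M))))) (z-inv i)) ⟨
      w * y i * (z i * (1# - x ^ p))
        ≈⟨ *-congˡ (*-congˡ (geometricSum p x)) ⟨
      w * y i * (z i * (rangeSum p (λ k → x ^ k) * (1# - x)))
        ≈⟨ solve 5 (λ w y z S e → w :* y :* (z :* (S :* e)) := (w :* S :* z) :* (y :* e)) refl w (y i) (z i) _ (1# - x) ⟩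
      (w * rangeSum p (λ k → x ^ k) * z i) * (y i * (1# - x))
        ≈⟨ trans (*-congˡ (y-inv i)) (*-identityʳ _) ⟩
      w * rangeSum p (λ k → x ^ k) * z i
        ≈⟨ *-congʳ (*-distribˡ-sum {p} w (λ k → x ^ toℕ k)) ⟩
      rangeSum p (λ k → w * x ^ k) * z i
        ≈⟨ *-distribʳ-sum {p} (z i) (λ k → w * x ^ toℕ k) ⟩
      rangeSum p (λ k → w * x ^ k * z i)
        ≈⟨ rangeSum-cong p (λ k _ → *-congʳ (trans (*-congˡ (sym (^-*ʳ (ξ i) k M))) (sym (^-+ (ξ i) j (k ℕ.* M))))) ⟩
      rangeSum p (λ k → ξ i ^ (j ℕ.+ k ℕ.* M) * z i) ∎
      where
      x = ξ i ^ M
      w = ξ i ^ j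

  module _ {c n : ℕ} .{{_ : NonZero c}} (ξ : Vector Carrier n) (ξ-root : ∀ i → ξ i ^ c ≈ 1#)
           (powerSum : ∀ e → 0 < e → e < c → sum (λ i → ξ i ^ e) ≈ - 1#)
           (c#0 : c · 1# # 0#)
           (M : ℕ) (c⊥M : Coprime c M) (y : Vector Carrier n) (y-inv : ∀ i → y i * (1# - ξ i ^ M) ≈ 1#) where

    private
      -- As M is prime to c, the multiples bM with 1 ≤ b ≤ c meet every residue modulo c, so these
      -- values exhaust the masses. In this order they form an arithmetic progression.
      h : ℕ → Carrier
      h b = mass ξ y (b ℕ.* M)

    -- Only bM modulo c matters, and it is not 0 since c is prime to M and does not divide b.
    powerSum-M : ∀ b → 0 < b → b < c → sum (λ i → ξ i ^ (b ℕ.* M)) ≈ - 1#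
    powerSum-M b 0<b b<c = trans (sum-cong-≋ {n} (λ i → trans (reflexive (≡.cong (ξ i ^_) decomposition))
        (^-periodic {c = c} (ξ-root i) e (b ℕ.* M ℕ./ c))))
      (powerSum e (ℕ.n≢0⇒n>0 e≢0) (ℕ.m%n<n (b ℕ.* M) c))
      where
      e = b ℕ.* M ℕ.% c
      decomposition : b ℕ.* M ≡ e ℕ.+ c ℕ.* (b ℕ.* M ℕ./ c)
      decomposition = ≡.trans (ℕ.m≡m%n+[m/n]*n (b ℕ.* M) c) (≡.cong (e ℕ.+_) (ℕ.*-comm _ c))
      e≢0 : e ≢ 0
      e≢0 e≡0 = ℕ.>⇒∤ {{ℕ.>-nonZero 0<b}} b<c (ℕ.coprime-divisor c⊥M
        (≡.subst (c ℕ.∣_) (ℕ.*-comm b M) (ℕ.m%n≡0⇒n∣m (b ℕ.* M) c e≡0)))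

    -- Since (ξ^(bM) - ξ^((b+1)M)) / (1 - ξ^M) = ξ^(bM), the difference of consecutive terms is a
    -- power sum, hence -1.
    h-suc : ∀ b → 0 < b → b < c → h (suc b) ≈ h b + 1#
    h-suc b 0<b b<c = begin
      h (suc b)
        ≈⟨ solve 2 (λ H S → H := (H :+ S) :- S) refl _ _ ⟩
      (h (suc b) + sum (λ i → ξ i ^ (b ℕ.* M))) - sum (λ i → ξ i ^ (b ℕ.* M))
        ≈⟨ +-cong (trans (sym (∑-distrib-+ {n} (λ i → ξ i ^ (suc b ℕ.* M) * y i) (λ i → ξ i ^ (b ℕ.* M))))
             (sum-cong-≋ {n} telescope)) (-‿cong (powerSum-M b 0<b b<c)) ⟩
      h b - - 1#
        ≈⟨ solve 1 (λ H → H :- (:- :1) := H :+ :1) refl _ ⟩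
      h b + 1# ∎
      where
      telescope : ∀ i → ξ i ^ (suc b ℕ.* M) * y i + ξ i ^ (b ℕ.* M) ≈ ξ i ^ (b ℕ.* M) * y i
      telescope i = begin
        ξ i ^ (M ℕ.+ b ℕ.* M) * y i + w                ≈⟨ +-cong (*-congʳ (^-+ (ξ i) M (b ℕ.* M))) (trans (sym (*-identityʳ w)) (*-congˡ (sym (y-inv i)))) ⟩
        (x * w) * y i + w * (y i * (1# - x))           ≈⟨ solve 3 (λ x w y → (x :* w) :* y :+ w :* (y :* (:1 :- x)) := w :* y) refl x w (y i) ⟩
        w * y i                                        ∎
        where
        x = ξ i ^ M
        w = ξ i ^ (b ℕ.* M)

    h-linear : ∀ b → b < c → h (suc b) ≈ h 1 + b · 1#
    h-linear zero    _   = sym (+-identityʳ _)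
    h-linear (suc b) b<c = begin
      h (suc (suc b))          ≈⟨ h-suc (suc b) (s≤s z≤n) b<c ⟩
      h (suc b) + 1#           ≈⟨ +-congʳ (h-linear b (ℕ.<-trans (ℕ.n<1+n b) b<c)) ⟩
      (h 1 + b · 1#) + 1#      ≈⟨ solve 2 (λ H b → (H :+ b) :+ :1 := H :+ (:1 :+ b)) refl _ _ ⟩
      h 1 + suc b · 1#         ∎

    -- For each root, x = ξ^M satisfies x^c = 1 with 1 - x invertible, so x + x^2 + ... + x^c = 0.
    h-sum : rangeSum c (λ b → h (suc b)) ≈ 0#
    h-sum = begin
      rangeSum c (λ b → h (suc b))
        ≈⟨ ∑-comm {c} {n} (λ b i → ξ i ^ (suc (toℕ b) ℕ.* M) * y i) ⟩
      sum (λ i → rangeSum c (λ b → ξ i ^ (suc b ℕ.* M) * y i))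
        ≈⟨ sum-cong-≋ {n} vanishes ⟩
      sum {n} (λ _ → 0#)
        ≈⟨ sum-replicate-zero n ⟩
      0# ∎
      where
      vanishes : ∀ i → rangeSum c (λ b → ξ i ^ (suc b ℕ.* M) * y i) ≈ 0#
      vanishes i = begin
        rangeSum c (λ b → ξ i ^ (suc b ℕ.* M) * y i)
          ≈⟨ rangeSum-cong c (λ b _ → trans (*-congʳ (^-*ʳ (ξ i) (suc b) M))
               (solve 3 (λ x w y → (x :* w) :* y := (x :* y) :* w) refl x (x ^ b) (y i))) ⟩
        rangeSum c (λ b → x * y i * x ^ b)
          ≈⟨ *-distribˡ-sum {c} (x * y i) (λ b → x ^ toℕ b) ⟨
        x * y i * S
          ≈⟨ trans (*-congˡ (y-inv i)) (*-identityʳ _) ⟨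
        x * y i * S * (y i * (1# - x))
          ≈⟨ solve 3 (λ x y S → x :* y :* S :* (y :* (:1 :- x)) := x :* y :* y :* (S :* (:1 :- x))) refl x (y i) S ⟩
        x * y i * y i * (S * (1# - x))
          ≈⟨ *-congˡ (trans (geometricSum c x) (+-congˡ (-‿cong x^c≈1))) ⟩
        x * y i * y i * (1# - 1#)
          ≈⟨ solve 2 (λ x y → x :* y :* y :* (:1 :- :1) := :0) refl x (y i) ⟩
        0# ∎
        where
        x = ξ i ^ M
        S = rangeSum c (λ b → x ^ b)
        x^c≈1 : x ^ c ≈ 1#
        x^c≈1 = trans (sym (^-* (ξ i) M c)) (trans (^-*ʳ (ξ i) M c) (trans (^-congˡ M (ξ-root i)) (1#^ M)))

    -- The c terms h 1, h 1 + 1, ... of the progression add up to 0; doubling their sum and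
    -- cancelling c determines the first term.
    h₁-doubled : h 1 + h 1 + (c · 1# - 1#) ≈ 0#
    h₁-doubled = *-cancel-#0 c#0 (begin
      c · 1# * (h 1 + h 1 + (c · 1# - 1#))
        ≈⟨ arithmeticSum c (h 1) ⟨
      rangeSum c (λ b → h 1 + b · 1#) + rangeSum c (λ b → h 1 + b · 1#)
        ≈⟨ +-cong linear linear ⟩
      0# + 0#
        ≈⟨ +-identityˡ 0# ⟩
      0# ∎)
      where
      linear : rangeSum c (λ b → h 1 + b · 1#) ≈ 0#
      linear = trans (rangeSum-cong c (λ b b<c → sym (h-linear b b<c))) h-sum

    -- The exponents j and bM agree modulo c, so the mass at j is `h b`, a known term of the
    -- progression.
    mass-doubled : ∀ {j b t} → 1 ℕ.≤ b → b ℕ.≤ c → b ℕ.* M ≡ j ℕ.+ c ℕ.* t →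
                   mass ξ y j + mass ξ y j ≈ (b ℕ.+ b) · 1# - suc c · 1#
    mass-doubled {j} {suc b} {t} _ b<c equation = begin
      mass ξ y j + mass ξ y j
        ≈⟨ +-cong mass≈ mass≈ ⟩
      (h 1 + b · 1#) + (h 1 + b · 1#)
        ≈⟨ solve 3 (λ H b c → (H :+ b) :+ (H :+ b) := (H :+ H :+ (c :- :1)) :+ (((:1 :+ b) :+ (:1 :+ b)) :- (:1 :+ c))) refl (h 1) (b · 1#) (c · 1#) ⟩
      (h 1 + h 1 + (c · 1# - 1#)) + ((suc b · 1# + suc b · 1#) - suc c · 1#)
        ≈⟨ trans (+-congʳ h₁-doubled) (+-identityˡ _) ⟩
      (suc b · 1# + suc b · 1#) - suc c · 1#
        ≈⟨ +-congʳ (×-homo-+ 1# (suc b) (suc b)) ⟨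
      (suc b ℕ.+ suc b) · 1# - suc c · 1# ∎
      where
      mass≈ : mass ξ y j ≈ h 1 + b · 1#
      mass≈ = begin
        mass ξ y j                   ≈⟨ sum-cong-≋ {n} (λ i → *-congʳ (^-periodic {c = c} (ξ-root i) j t)) ⟨
        mass ξ y (j ℕ.+ c ℕ.* t)     ≡⟨ ≡.cong (mass ξ y) equation ⟨
        h (suc b)                    ≈⟨ h-linear b b<c ⟩
        h 1 + b · 1#                 ∎

-- Absolute values of images of p-adic integers, and division by 2.

module Valuation {a ℓ₁ ℓ₂ : Level} (p : ℕ) (p-prime : Prime p) (E : Padic.ValuedExtension p p-prime a ℓ₁ ℓ₂) where
  open Padic p p-prime
  open PadicCongruences p p-prime
  open ValuedExtension E
  open K using (Carrier; _≈_; _#_; 0#; 1#; _+_; _*_; -_; _-_; commutativeRing)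
  open HeytingProperties K.heytingCommutativeRing using (#-congʳ)
  open CommutativeRing commutativeRing using (semiring)
  open SemiringMult semiring using () renaming (_×_ to _·_)
  open MonicPolynomials heytingField using (*-#0ʳ; #0⇒inverse)
  open RingSolver commutativeRing
  open IsRingHomomorphism ι-homo public using (⟦⟧-cong; +-homo; *-homo; -‿homo; 0#-homo; 1#-homo)

  fromℤ-suc : ∀ n → ℚ.fromℤ (+ suc n) ≡ ℚ.fromℤ 1ℤ ℚ.+ ℚ.fromℤ (+ n)
  fromℤ-suc n = ℚ.toℚᵘ-injective (ℚᵘ.≃-trans (ℚᵘ.*≡* (eq (+ n)))
    (ℚᵘ.≃-sym (ℚ.toℚᵘ-homo-+ (ℚ.fromℤ 1ℤ) (ℚ.fromℤ (+ n)))))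
    where
    eq : ∀ x → (1ℤ ℤ.+ x) ℤ.* 1ℤ ≡ (1ℤ ℤ.* 1ℤ ℤ.+ x ℤ.* 1ℤ) ℤ.* 1ℤ
    eq = ℤ.solve-∀

  fromℤ-mono-< : ∀ {m n} → m < n → ℚ.fromℤ (+ m) ℚ.< ℚ.fromℤ (+ n)
  fromℤ-mono-< {m} {n} m<n = ℚ.*<* (≡.subst₂ ℤ._<_ (≡.sym (ℤ.*-identityʳ (+ m))) (≡.sym (ℤ.*-identityʳ (+ n))) (ℤ.+<+ m<n))

  ∣ₚ-lower : ∀ x {m n} → m ℕ.≤ n → n ∣ₚ x → m ∣ₚ x
  ∣ₚ-lower x m≤n h = mod⇒∣ (approx-≤ x m≤n) (∣-trans (P-mono m≤n) h)

  -- Divisibility by pⁿ is decidable, so x without an exact valuation is zero.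

  ∣ₚ-all : ∀ x → (∀ n → n ∣ₚ x → ¬ suc n ∣ₚ x → ⊥) → ∀ n → n ∣ₚ x
  ∣ₚ-all x h zero    = P0∣ _
  ∣ₚ-all x h (suc n) with P (suc n) ∣? approx x (suc n)
  ... | yes d = d
  ... | no ¬d = ⊥-elim (h n (∣ₚ-all x h n) ¬d)

  -- An exact valuation of x - y would put its image apart from 0, so there is none and every power
  -- of p divides x - y.
  ι-injective : ∀ {x y} → ι x ≈ ι y → ∀ m → x ≈[ m ] y
  ι-injective {x} {y} e m = ∣⇒≈[] (∣ₚ-all (x -ₚ y)
    (λ n d ¬d → K.#-irrefl ι[x-y]≈0 (proj₁ (v-ι (x -ₚ y) n d ¬d))) m)
    where
    ι[x-y]≈0 : ι (x -ₚ y) ≈ 0#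
    ι[x-y]≈0 = K.trans (+-homo x (-ₚ y)) (K.trans (K.+-cong e (-‿homo y)) (K.-‿inverseʳ (ι y)))

  ‖‖-cong : ∀ {x y m} → x ≈ y → ‖ x ‖<p^- m → ‖ y ‖<p^- m
  ‖‖-cong {m = m} x≈y h y#0 = ≡.subst (ℚ.fromℤ (+ m) ℚ.<_) (v-cong x#0 y#0 x≈y) (h x#0)
    where x#0 = #-congʳ (K.sym x≈y) y#0

  -- Whether x is zero cannot be decided, but the order of the rationals can. Were the valuation not
  -- above m, x could have no exact valuation n, as divisibility by p^(m+1) forces n > m; then x
  -- would be zero, against the apartness of its image from 0.
  ‖ι‖< : ∀ x m → suc m ∣ₚ x → ‖ ι x ‖<p^- m
  ‖ι‖< x m d ιx#0 with ℚ.fromℤ (+ m) ℚ.<? v ιx#0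
  ... | yes m<v = m<v
  ... | no  m≮v = ⊥-elim (K.#-irrefl (K.trans (⟦⟧-cong x≈0) 0#-homo) ιx#0)
    where
    exact : ∀ n → n ∣ₚ x → ¬ suc n ∣ₚ x → ⊥
    exact n e ¬e with v-ι x n e ¬e
    ... | ιx#0′ , v≡n = m≮v (≡.subst (ℚ.fromℤ (+ m) ℚ.<_)
      (≡.trans (≡.sym v≡n) (v-cong ιx#0′ ιx#0 K.refl))
      (fromℤ-mono-< (ℕ.≰⇒> (λ n≤m → ¬e (∣ₚ-lower x (s≤s n≤m) d)))))
    x≈0 : x ≈ₚ 0ₚ
    x≈0 = equal (λ n → mod (≡.subst (P n ∣_) (≡.sym (ℤ.+-identityʳ (approx x n))) (∣ₚ-all x exact n)))

  two : Carrier
  two = ι (fromℤ (+ 2))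

  -- The valuation of 2 is 1 for p = 2 and 0 otherwise; the common upper bound says that halving
  -- costs at most one digit.
  two-valuation : Σ[ two#0 ∈ two # 0# ] v two#0 ℚ.≤ ℚ.fromℤ 1ℤ
  two-valuation with p ℕ.≟ 2
  ... | yes p≡2 with v-ι (fromℤ (+ 2)) 1 (≡.subst (λ q → + (q ℕ.^ 1) ∣ + 2) (≡.sym p≡2) (divides 1ℤ ≡.refl))
                       (λ d → ℕ.>⇒∤ {2} {4} (s≤s (s≤s (s≤s z≤n))) (∣⇒∣ᵤ (≡.subst (λ q → + (q ℕ.^ 2) ∣ + 2) p≡2 d)))
  ...   | two#0 , v≡1 = two#0 , ℚ.≤-reflexive v≡1
  two-valuation | no p≢2 with v-ι (fromℤ (+ 2)) 0 (P0∣ _) (λ d → p≢2 (ℕ.≤-antisym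
                         (ℕ.∣⇒≤ (∣⇒∣ᵤ (≡.subst (_∣ + 2) P1≡p d))) (ℕ.nonTrivial⇒n>1 p {{prime⇒nonTrivial p-prime}})))
  ...   | two#0 , v≡0 = two#0 , ≡.subst (ℚ._≤ ℚ.fromℤ 1ℤ) (≡.sym v≡0) (ℚ.<⇒≤ (fromℤ-mono-< {0} {1} (s≤s z≤n)))

  half : Carrier
  half = proj₁ (#0⇒inverse (proj₁ two-valuation))

  half-inverse : half * two ≈ 1#
  half-inverse = proj₂ (#0⇒inverse (proj₁ two-valuation))

  -- The valuation of x is that of 2 plus that of x/2, and the former is at most 1.
  ‖half‖< : ∀ {x} m → ‖ x ‖<p^- suc m → ‖ half * x ‖<p^- m
  ‖half‖< {x} m h y#0 = ℚ.≰⇒> (λ v≤m → ℚ.<-irrefl ≡.refl (ℚ.<-≤-trans (h x#0) (≡.subst₂ ℚ._≤_ (≡.sym v-two) (≡.sym (fromℤ-suc m))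
      (ℚ.+-mono-≤ (proj₂ two-valuation) v≤m))))
    where
    two#0 = proj₁ two-valuation
    x#0 : x # 0#
    x#0 = *-#0ʳ y#0
    two*y≈x : two * (half * x) ≈ x
    two*y≈x = K.trans (solve 3 (λ t h x → t :* (h :* x) := (h :* t) :* x) K.refl two half x)
      (K.trans (K.*-congʳ half-inverse) (K.*-identityˡ x))
    two*y#0 : two * (half * x) # 0#
    two*y#0 = #-congʳ (K.sym two*y≈x) x#0
    v-two : v x#0 ≡ v two#0 ℚ.+ v y#0
    v-two = ≡.trans (v-cong x#0 two*y#0 (K.sym two*y≈x)) (v-* two#0 y#0 two*y#0)

  ‖half^‖< : ∀ r {x} m → ‖ x ‖<p^- (r ℕ.+ m) → ‖ half K.^ r * x ‖<p^- m
  ‖half^‖< zero    {x} m h = ‖‖-cong (K.sym (K.*-identityˡ x)) h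
  ‖half^‖< (suc r) {x} m h = ‖‖-cong (K.sym (K.*-assoc half (half K.^ r) x))
    (‖half‖< m (‖half^‖< r (suc m) (≡.subst (‖ x ‖<p^-_) (≡.sym (ℕ.+-suc r m)) h)))

  ι-unit : ∀ x → ¬ 1 ∣ₚ x → ι x # 0#
  ι-unit x ¬d = proj₁ (v-ι x 0 (P0∣ _) ¬d)

  ι-ℕ : ∀ n → ι (fromℤ (+ n)) ≈ n · 1#
  ι-ℕ zero    = 0#-homo
  ι-ℕ (suc n) = K.trans (⟦⟧-cong {fromℤ (+ suc n)} {1ₚ +ₚ fromℤ (+ n)} (equal (λ _ → mod-refl)))
    (K.trans (+-homo 1ₚ (fromℤ (+ n))) (K.+-cong 1#-homo (ι-ℕ n)))

  ι-difference : ∀ m n → ι (fromℤ (+ m ℤ.- + n)) ≈ m · 1# - n · 1#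
  ι-difference m n = K.trans (⟦⟧-cong {fromℤ (+ m ℤ.- + n)} {fromℤ (+ m) -ₚ fromℤ (+ n)} (equal (λ _ → mod-refl)))
    (K.trans (+-homo (fromℤ (+ m)) (-ₚ fromℤ (+ n))) (K.+-cong (ι-ℕ m)
      (K.trans (-‿homo (fromℤ (+ n))) (K.-‿cong (ι-ℕ n)))))

-- Riemann sums in the field as images of doubled sums, and the extended L-function.

module Interpolation {a ℓ₁ ℓ₂ : Level} (p : ℕ) (p-prime : Prime p) (ℂₚ : Padic.PadicComplexNumbers p p-prime a ℓ₁ ℓ₂) where
  open Padic p p-prime
  open PadicCongruences p p-prime
  open RegularizedMeasure p p-prime
  open PadicComplexNumbers ℂₚ
  open Measures ℂₚ
  open Valuation p p-prime valuedExtension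
  open K using (Carrier; _≈_; _#_; 0#; 1#; _+_; _*_; -_; _-_; commutativeRing)
  open HeytingProperties K.heytingCommutativeRing using (#-congʳ)
  open CommutativeRing commutativeRing using (semiring)
  open SemiringMult semiring using () renaming (_×_ to _·_)
  open SemiringSum semiring using (*-distribˡ-sum)
  open MonicPolynomials heytingField using (eval)
  open RootMasses heytingField using (mass; mass-additive; mass-doubled)
  open RingSolver commutativeRing
  open BoxSums K.isCommutativeRing using (rangeSum; rangeSum-cong)
  open SetoidReasoning K.setoid

  private
    module ℤₚSums = RawBoxSums _+ₚ_ _*ₚ_ 0ₚ

  monic≈eval : ∀ {n} (b : Vector Carrier n) x → monic b x ≈ eval b x
  monic≈eval {zero}  b x = K.+-identityʳ 1#
  monic≈eval {suc n} b x = begin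
    x * x K.^ n + (head b * 1# + K.sum (λ i → tail b i * (x * x K.^ toℕ i)))
      ≈⟨ K.+-congˡ (K.+-congˡ (SemiringSum.sum-cong-≋ semiring {n} (λ i →
           solve 3 (λ b x y → b :* (x :* y) := x :* (b :* y)) K.refl (tail b i) x (x K.^ toℕ i)))) ⟩
    x * x K.^ n + (head b * 1# + K.sum (λ i → x * (tail b i * x K.^ toℕ i)))
      ≈⟨ K.+-congˡ (K.+-congˡ (*-distribˡ-sum {n} x (λ i → tail b i * x K.^ toℕ i))) ⟨
    x * x K.^ n + (head b * 1# + x * K.sum (λ i → tail b i * x K.^ toℕ i))
      ≈⟨ solve 4 (λ b x y S → x :* y :+ (b :* :1 :+ x :* S) := b :+ x :* (y :+ S)) K.refl (head b) x (x K.^ n) _ ⟩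
    head b + x * monic (tail b) x
      ≈⟨ K.+-congˡ (K.*-congˡ (monic≈eval (tail b) x)) ⟩
    head b + x * eval (tail b) x ∎

  closed : ∀ n (b : Vector Carrier (suc n)) → ∃ λ x → eval b x ≈ 0#
  closed n b with algebraicallyClosed n b
  ... | x , e = x , K.trans (K.sym (monic≈eval b x)) e

  coprime⇒#0 : ∀ {c} → Coprime c p → c · 1# # 0#
  coprime⇒#0 {c} c⊥p = #-congʳ (ι-ℕ c) (ι-unit (fromℤ (+ c)) (λ d → ℕ.nonTrivial⇒≢1 {{prime⇒nonTrivial p-prime}}
    (c⊥p (∣⇒∣ᵤ (≡.subst (_∣ + c) P1≡p d) , ℕ.∣-refl))))

  coprime-^ : ∀ {c} → Coprime c p → ∀ N → Coprime c (p ℕ.^ N)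
  coprime-^ c⊥p zero    (_ , d∣1) = ℕ.∣1⇒≡1 d∣1
  coprime-^ {c} c⊥p (suc N) {d} (d∣c , d∣) = coprime-^ c⊥p N (d∣c , ℕ.coprime-divisor d⊥p d∣)
    where
    d⊥p : Coprime d p
    d⊥p (e∣d , e∣p) = c⊥p (ℕ.∣-trans e∣d d∣c , e∣p)

  module Roots (d : ℕ) (c⊥p : Coprime (suc d) p) where
    open RootsOfUnity heytingField
    private
      c#0 = coprime⇒#0 {suc d} c⊥p

    opaque
      roots : NontrivialRoots (suc d)
      roots = record
        { count    = d
        ; root     = ζ closed d c#0
        ; isRoot   = λ i → ζ-root closed d c#0 i , ζ-nontrivial closed d c#0 i
        ; distinct = distinct closed d c#0
        ; covers   = λ ξ (e , ξ#1) → ζ-covers closed d c#0 ξ e ξ#1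
        }

      powerSum : ∀ n → 0 < n → n < suc d → K.sum (λ i → NontrivialRoots.root roots i K.^ n) ≈ - 1#
      powerSum n 0<n n<c = ζ-powerSum closed d c#0 n 0<n (ℕ.≤-pred n<c)

    open NontrivialRoots roots

    inverses : ℕ → Vector Carrier count
    inverses N i = proj₁ (K.#⇒invertible (nonvanishing c⊥p (isRoot i) N))

    inverses-correct : ∀ N i → inverses N i * (1# - root i K.^ (p ℕ.^ N)) ≈ 1#
    inverses-correct N i = proj₁ (proj₂ (K.#⇒invertible (nonvanishing c⊥p (isRoot i) N)))

    μ : ℕ → ℕ → Carrier
    μ N = mass root (inverses N)

    μ-doubled : ∀ N j → j < p ℕ.^ N → μ N j + μ N j ≈ ι (weightₚ (suc d) c⊥p N j)
    μ-doubled N j j<p^N = K.trans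
      (mass-doubled {suc d} {count} root (λ i → proj₁ (isRoot i)) powerSum c#0 (p ℕ.^ N) (coprime-^ c⊥p N) (inverses N)
        (inverses-correct N) {j} {Index.a i} {Index.t i} (index-≥1 (s≤s z≤n) i) (index-≤c j<p^N i) (Index.equation i))
      (K.sym (ι-difference (Index.a i ℕ.+ Index.a i) (suc (suc d))))
      where i = index (suc d) c⊥p N j

    μ≈half : ∀ N j → j < p ℕ.^ N → μ N j ≈ half * ι (weightₚ (suc d) c⊥p N j)
    μ≈half N j j<p^N = begin
      μ N j                                     ≈⟨ K.*-identityˡ (μ N j) ⟨
      1# * μ N j                                ≈⟨ K.*-congʳ half-inverse ⟨
      half * two * μ N j                        ≈⟨ K.*-congʳ (K.*-congˡ (ι-ℕ 2)) ⟩
      half * (1# + (1# + 0#)) * μ N j           ≈⟨ solve 2 (λ h m → h :* (:1 :+ (:1 :+ :0)) :* m := h :* (m :+ m)) K.refl half (μ N j) ⟩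
      half * (μ N j + μ N j)                    ≈⟨ K.*-congˡ (μ-doubled N j j<p^N) ⟩
      half * ι (weightₚ (suc d) c⊥p N j)        ∎

  ι-rangeSum : ∀ n (f : ℕ → ℤₚ) → ι (ℤₚSums.rangeSum n f) ≈ rangeSum n (λ j → ι (f j))
  ι-rangeSum zero    f = 0#-homo
  ι-rangeSum (suc n) f = K.trans (+-homo (f 0) (ℤₚSums.rangeSum n (f ∘ suc))) (K.+-congˡ (ι-rangeSum n (f ∘ suc)))

  cell-< : ∀ {m n i j} → j < n → i < m → j ℕ.+ i ℕ.* n < m ℕ.* n
  cell-< {m} {n} {i} j<n i<m = ℕ.<-≤-trans (ℕ.+-monoˡ-< (i ℕ.* n) j<n) (ℕ.*-monoˡ-≤ n i<m)

  -- Proved in the field, where the doubled mass is the image of the weight and the geometric series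
  -- splits it; injectivity of `ι` then brings the identity back to `ℤₚ`.
  additive : ∀ c → 1 < c → (c⊥p : Coprime c p) → Additive c c⊥p
  additive (suc d) _ c⊥p m N j j<p^N = ι-injective {weightₚ (suc d) c⊥p N j} {ℤₚSums.rangeSum p refined} (begin
    ι (weightₚ (suc d) c⊥p N j)
      ≈⟨ μ-doubled N j j<p^N ⟨
    μ N j + μ N j
      ≈⟨ K.+-cong split split ⟩
    rangeSum p (λ k → μ (suc N) (j ℕ.+ k ℕ.* p ℕ.^ N)) + rangeSum p (λ k → μ (suc N) (j ℕ.+ k ℕ.* p ℕ.^ N))
      ≈⟨ SemiringSum.∑-distrib-+ semiring {p} (λ k → μ (suc N) (j ℕ.+ toℕ k ℕ.* p ℕ.^ N)) (λ k → μ (suc N) (j ℕ.+ toℕ k ℕ.* p ℕ.^ N)) ⟨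
    rangeSum p (λ k → μ (suc N) (j ℕ.+ k ℕ.* p ℕ.^ N) + μ (suc N) (j ℕ.+ k ℕ.* p ℕ.^ N))
      ≈⟨ rangeSum-cong p (λ k k<p → μ-doubled (suc N) (j ℕ.+ k ℕ.* p ℕ.^ N) (cell-< {p} {p ℕ.^ N} {k} {j} j<p^N k<p)) ⟩
    rangeSum p (λ k → ι (refined k))
      ≈⟨ ι-rangeSum p refined ⟨
    ι (ℤₚSums.rangeSum p refined) ∎) m
    where
    open Roots d c⊥p
    refined : ℕ → ℤₚ
    refined k = weightₚ (suc d) c⊥p (suc N) (j ℕ.+ k ℕ.* p ℕ.^ N)
    split : μ N j ≈ rangeSum p (λ k → μ (suc N) (j ℕ.+ k ℕ.* p ℕ.^ N))
    split = mass-additive p (p ℕ.^ N) (NontrivialRoots.root roots) (inverses N) (inverses (suc N))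
      (inverses-correct N) (inverses-correct (suc N)) j

  sumOverBox-cong : ∀ r n {f g : Vector ℕ r → Carrier} → (∀ js → f js ≈ g js) → sumOverBox r n f ≈ sumOverBox r n g
  sumOverBox-cong zero    n h = h []
  sumOverBox-cong (suc r) n {f} {g} h = rangeSum-cong n {λ j → sumOverBox r n (λ js → f (j ∷ js))}
    (λ j _ → sumOverBox-cong r n (λ js → h (j ∷ js)))

  sumOverBox-*ˡ : ∀ r n x (f : Vector ℕ r → Carrier) → sumOverBox r n (λ js → x * f js) ≈ x * sumOverBox r n f
  sumOverBox-*ˡ zero    n x f = K.refl
  sumOverBox-*ˡ (suc r) n x f = K.trans
    (rangeSum-cong n {λ j → sumOverBox r n (λ js → x * f (j ∷ js))} (λ j _ → sumOverBox-*ˡ r n x (λ js → f (j ∷ js))))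
    (K.sym (*-distribˡ-sum {n} x (λ j → sumOverBox r n (λ js → f (toℕ j ∷ js)))))

  module _ (n : ℕ) (m : ℕ → Carrier) (w : ℕ → ℤₚ) (m≈half : ∀ j → j < n → m j ≈ half * ι (w j)) where

    -- Each coordinate contributes one `half` through its mass; these collect into a power, and what
    -- remains is the image of a single element of `ℤₚ`.
    sumOverBox-half : ∀ r (F : Vector ℕ r → ℤₚ) →
      sumOverBox r n (λ js → ι (F js) * K.product (λ i → m (js i))) ≈ half K.^ r * ι (ℤₚSums.weightedSum r n w F)
    sumOverBox-half zero    F = K.*-comm (ι (F [])) 1#
    sumOverBox-half (suc r) F = begin
      rangeSum n (λ j → sumOverBox r n (λ js → ι (F (j ∷ js)) * (m j * K.product (λ i → m (js i)))))
        ≈⟨ rangeSum-cong n {λ j → sumOverBox r n (λ js → ι (F (j ∷ js)) * (m j * K.product (λ i → m (js i))))} cell ⟩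
      rangeSum n (λ j → half K.^ suc r * ι (w j *ₚ inner j))
        ≈⟨ *-distribˡ-sum {n} (half K.^ suc r) (λ j → ι (w (toℕ j) *ₚ inner (toℕ j))) ⟨
      half K.^ suc r * rangeSum n (λ j → ι (w j *ₚ inner j))
        ≈⟨ K.*-congˡ (ι-rangeSum n (λ j → w j *ₚ inner j)) ⟨
      half K.^ suc r * ι (ℤₚSums.rangeSum n (λ j → w j *ₚ inner j)) ∎
      where
      inner : ℕ → ℤₚ
      inner j = ℤₚSums.weightedSum r n w (λ js → F (j ∷ js))
      cell : ∀ j → j < n → sumOverBox r n (λ js → ι (F (j ∷ js)) * (m j * K.product (λ i → m (js i)))) ≈
                           half K.^ suc r * ι (w j *ₚ inner j)
      cell j j<n = begin
        sumOverBox r n (λ js → ι (F (j ∷ js)) * (m j * K.product (λ i → m (js i))))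
          ≈⟨ sumOverBox-cong r n (λ js → solve 3 (λ x y z → x :* (y :* z) := y :* (x :* z)) K.refl
               (ι (F (j ∷ js))) (m j) (K.product (λ i → m (js i)))) ⟩
        sumOverBox r n (λ js → m j * (ι (F (j ∷ js)) * K.product (λ i → m (js i))))
          ≈⟨ sumOverBox-*ˡ r n (m j) (λ js → ι (F (j ∷ js)) * K.product (λ i → m (js i))) ⟩
        m j * sumOverBox r n (λ js → ι (F (j ∷ js)) * K.product (λ i → m (js i)))
          ≈⟨ K.*-cong (m≈half j j<n) (sumOverBox-half r (λ js → F (j ∷ js))) ⟩
        half * ι (w j) * (half K.^ r * ι (inner j))
          ≈⟨ solve 4 (λ h x y z → h :* x :* (y :* z) := h :* y :* (x :* z)) K.refl half (ι (w j)) (half K.^ r) (ι (inner j)) ⟩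
        half K.^ suc r * (ι (w j) * ι (inner j))
          ≈⟨ K.*-congˡ (*-homo (w j) (inner j)) ⟨
        half K.^ suc r * ι (w j *ₚ inner j) ∎

  -- The surplus r + 1 in the congruence pays r digits for the halves and one for the strict
  -- inequality.
  ‖half^ι-‖< : ∀ r m (x y : ℤₚ) → x ≈[ suc (r ℕ.+ m) ] y → ‖ half K.^ r * ι x - half K.^ r * ι y ‖<p^- m
  ‖half^ι-‖< r m x y x≈y = ‖‖-cong (begin
    half K.^ r * ι (x -ₚ y)                ≈⟨ K.*-congˡ (K.trans (+-homo x (-ₚ y)) (K.+-congˡ (-‿homo y))) ⟩
    half K.^ r * (ι x - ι y)               ≈⟨ solve 3 (λ h x y → h :* (x :- y) := h :* x :- h :* y) K.refl (half K.^ r) (ι x) (ι y) ⟩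
    half K.^ r * ι x - half K.^ r * ι y    ∎)
    (‖half^‖< r m (‖ι‖< (x -ₚ y) (r ℕ.+ m) (≈[]⇒∣ x≈y)))

  riemannSum≈ : ∀ {r} (f : Vector ℤₚ r → ℤₚ) d (c⊥p : Coprime (suc d) p) N →
    riemannSum (𝔪̃ (Roots.roots d c⊥p) c⊥p) f N ≈ half K.^ r * ι (doubledSum f (suc d) c⊥p N)
  riemannSum≈ {r} f d c⊥p N = sumOverBox-half (p ℕ.^ N) (μ N) (weightₚ (suc d) c⊥p N) (μ≈half N) r (sample f)
    where open Roots d c⊥p

  module _ {r : ℕ} (f : Vector ℤₚ r → ℤₚ) (f-lip : Lipschitz f) where
    open Integral additive f f-lip

    hasIntegral : ∀ d → 1 < suc d → (c⊥p : Coprime (suc d) p) →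
      HasIntegral (𝔪̃ (Roots.roots d c⊥p) c⊥p) f (half K.^ r * ι (doubledIntegral (fromℕˣ (suc d) c⊥p)))
    -- The doubled integral is needed modulo p^(r+m+1), and `doubledIntegral-limit` gives this for N
    -- strictly larger than r + m + 1.
    hasIntegral d 1<c c⊥p m = suc (suc (r ℕ.+ m)) , λ N N₀≤N →
      ‖‖-cong {half K.^ r * ι (doubledSum f (suc d) c⊥p N) - half K.^ r * ι (doubledIntegral (fromℕˣ (suc d) c⊥p))}
        {riemannSum (𝔪̃ (Roots.roots d c⊥p) c⊥p) f N - half K.^ r * ι (doubledIntegral (fromℕˣ (suc d) c⊥p))} {m}
        (K.+-congʳ (K.sym (riemannSum≈ f d c⊥p N)))
        (‖half^ι-‖< r m (doubledSum f (suc d) c⊥p N) (doubledIntegral (fromℕˣ (suc d) c⊥p))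
          (doubledIntegral-limit (suc d) 1<c c⊥p N (suc (r ℕ.+ m)) N₀≤N))

  module LFunction {r : ℕ} (k : Vector ℤ r) (γ : Vector ℤₚ r) where

    integrand-lipschitz : ∀ s → Lipschitz (integrand s k γ)
    integrand-lipschitz s m {x} {y} x≈y = integrand-cong m s s k γ {x} {y} (λ _ → ≈[]-refl) x≈y

    doubledL : Vector ℤₚ r → ℤₚˣ → ℤₚ
    doubledL s = Integral.doubledIntegral additive (integrand s k γ) (integrand-lipschitz s)

    L : Vector ℤₚ r → ℤₚˣ → Carrier
    L s c = half K.^ r * ι (doubledL s c)

    L-value : ∀ s c → 1 < c → (c⊥p : Coprime c p) → IsLValue s k γ c c⊥p (L s (fromℕˣ c c⊥p))
    L-value s (suc d) 1<c c⊥p = Roots.roots d c⊥p , hasIntegral (integrand s k γ) (integrand-lipschitz s) d 1<c c⊥p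

    L-uniform : ∀ m → ∃[ n ] ((c c′ : ℤₚˣ) → ∣ value c -ₚ value c′ ∣<p^- n →
      (s s′ : Vector ℤₚ r) → (∀ j → ∣ s j -ₚ s′ j ∣<p^- n) → ‖ L s c - L s′ c′ ‖<p^- m)
    -- M digits of the doubled integral suffice for the bound after halving. They require `level M`
    -- digits of c and M digits of s; the bound at `level M`, being strict, supplies one digit more
    -- than c needs.
    L-uniform m = level M , λ c c′ c≈c′ s s′ s≈s′ → ‖half^ι-‖< r m (doubledL s c) (doubledL s′ c′)
      (doubledIntegral-cong additive (integrand s k γ) (integrand s′ k γ) (integrand-lipschitz s) (integrand-lipschitz s′) c c′ M
        (λ x → integrand-cong M s s′ k γ {x} {x}
          (λ j → ≈[]-lower {x = s j} {s′ j} (ℕ.≤-trans (ℕ.n≤1+n M) (ℕ.≤-trans (ℕ.m≤m+n (suc M) M) (ℕ.n≤1+n (level M))))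
                   (∣⇒≈[] (s≈s′ j)))
          (λ _ → ≈[]-refl))
        (≈[]-lower {x = value c} {value c′} (ℕ.n≤1+n (level M)) (∣⇒≈[] c≈c′)))
      where M = suc (r ℕ.+ m)

    L-continuous : ∀ s c m → ∃[ n ] ((c′ : ℤₚˣ) → ∣ value c -ₚ value c′ ∣<p^- n → ‖ L s c - L s c′ ‖<p^- m)
    L-continuous s c m = proj₁ (L-uniform m) , λ c′ c≈c′ →
      proj₂ (L-uniform m) c c′ c≈c′ s s (λ j → ≈[]⇒∣ (≈[]-refl {suc (proj₁ (L-uniform m))} {s j}))

theorem2p17 :
    {a ℓ₁ ℓ₂ : Level} (p : ℕ) (p-prime : Prime p) →
    let open Padic p p-prime in
    (ℂₚ : PadicComplexNumbers a ℓ₁ ℓ₂) →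
    let open PadicComplexNumbers ℂₚ
        open Measures ℂₚ in
    (r : ℕ) .{{_ : NonZero r}} (k : Vector ℤ r) (γ : Vector ℤₚ r) →
    Σ[ L ∈ (Vector ℤₚ r → ℤₚˣ → K.Carrier) ]
      ((s : Vector ℤₚ r) (c : ℕ) → 1 < c → (c⊥p : Coprime c p) →
         IsLValue s k γ c c⊥p (L s (fromℕˣ c c⊥p)))
      ×
      ((s : Vector ℤₚ r) (c : ℤₚˣ) (m : ℕ) →
         ∃[ n ] ((c′ : ℤₚˣ) → ∣ value c -ₚ value c′ ∣<p^- n →
           ‖ L s c K.- L s c′ ‖<p^- m))
      ×
      ((m : ℕ) →
         ∃[ n ] ((c c′ : ℤₚˣ) → ∣ value c -ₚ value c′ ∣<p^- n →
           (s s′ : Vector ℤₚ r) → (∀ j → ∣ s j -ₚ s′ j ∣<p^- n) →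
           ‖ L s c K.- L s′ c′ ‖<p^- m))
theorem2p17 p p-prime ℂₚ r k γ = L , L-value , L-continuous , L-uniform
  where open Interpolation.LFunction p p-prime ℂₚ k γ
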